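{- Let $\mathbb{F}$ be a field of characteristic zero, let $J\ge0$, and let $r,i$ be integers with $r\ge2$ and $1\le i\le r$. Define power series $N^{J}_{i,j,(r-1)d+j}\in\mathbb{F}[[q]]$ for integers $d\ge J+1$ and $1\le j\le r$ by the initial conditions $$N^{J}_{i,j,(r-1)(J+1)+j}=\begin{cases} q^{2(J+1)j-1}+q^{2(J+1)(j-1)} & 1\le j\le i-1,\\ q^{2(J+1)(j-1)} & j=i,\\ 0 & i+1\le j\le r,\end{cases}$$ and the recursion, for $d\ge J+1$ and $1\le j\le r$, $$N^{J}_{i,j,(r-1)(d+1)+j}=q^{2(d+1)(j-1)}\sum_{m=1}^{r-j+1}N^{J}_{i,m,(r-1)d+m}+q^{2(d+1)j-1}\sum_{m=1}^{r-j}N^{J}_{i,m,(r-1)d+m}.$$ Then for every $d\ge J+1$, $$\mathrm{HP}^{2J+1}_i=\sum_{j=1}^{r}N^{J}_{i,j,(r-1)d+j}\,\mathrm{HP}^{2d+1}_{r-j+1}.$$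
   Context: For an integer $k\ge1$ let $S_k=\mathbb{F}[x_k,x_{k+1},x_{k+2},\ldots]$, graded by weight, where the monomial $x_{i_1}^{\alpha_1}\cdots x_{i_m}^{\alpha_m}$ has weight $\sum_t i_t\alpha_t$. For a homogeneous ideal $I$ of $S_k$, the Hilbert–Poincaré series is $\mathrm{HP}(S_k/I)=\sum_{j\ge0}\dim_{\mathbb{F}}(S_k/I)_j\,q^j$. With $r\ge2$ fixed, define the monomial ideal $$L_k=\big(x_{2a-1}^2,\ x_{2b-1}x_{2b}^{r-1},\ x_{2c}^{r-n_1}x_{2c+2}^{n_1},\ x_{2c}^{r-n_2-1}x_{2c+1}x_{2c+2}^{n_2}\ :\ 2a-1,2b-1,2c\ge k,\ 0\le n_1\le r-1,\ 0\le n_2\le r-2\big)\subseteq S_k,$$ and for $1\le \ell\le r$ define $L_k^{\ell}\subseteq S_k$ by: if $k$ is even, $$L_k^{\ell}=\big(x_k^{\ell},\ x_k^{\ell-t}x_{k+2}^{r-\ell+t}\ (1\le t\le \ell-1),\ x_k^{\ell-t}x_{k+1}x_{k+2}^{r-\ell+t-1}\ (1\le t\le \ell-1),\ L_{k+1}\big);$$ if $k$ is odd, $L_k^{\ell}=\big(x_k^2,\ x_kx_{k+1}^{\ell-1},\ L_{k+1}^{\ell}\big)$. Write $\mathrm{HP}^k_{\ell}=\mathrm{HP}(S_k/L_k^{\ell})$. -}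

module Defs where

open import Data.Nat using (ℕ; zero; suc; _+_; _*_; _∸_; _≤ᵇ_; _≡ᵇ_)
open import Data.Nat.DivMod using (_%_)
open import Data.Bool using (Bool; true; false; _∧_; _∨_; not; if_then_else_)
open import Data.List using (List; []; _∷_; map; concatMap; filter; length; upTo)
open import Data.Bool.ListAction using (any)

-- Formal power series in q with ℕ coefficients: coefficient functions.

Series : Set
Series = ℕ → ℕ

qpow : ℕ → Series
qpow a n = if a ≡ᵇ n then 1 else 0

_⊕_ : Series → Series → Series
(f ⊕ g) n = f n + g n

zeroS : Series
zeroS _ = 0

convAux : Series → Series → ℕ → ℕ → ℕ
convAux f g n zero    = f 0 * g n
convAux f g n (suc m) = f (suc m) * g (n ∸ suc m) + convAux f g n m

_⊛_ : Series → Series → Series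
(f ⊛ g) n = convAux f g n n

ΣS : (ℕ → Series) → ℕ → Series
ΣS f zero    = zeroS
ΣS f (suc n) = ΣS f n ⊕ f (suc n)

-- Monomials of S_k = F[x_k, x_{k+1}, …] (k ≥ 1).
-- A monomial is given by its exponent function on absolute indices.

Exp : Set
Exp = ℕ → ℕ

-- exponent list xs, with xs[t] = exponent of x_{k+t}
nth : List ℕ → ℕ → ℕ
nth []       _       = 0
nth (x ∷ xs) zero    = x
nth (x ∷ xs) (suc t) = nth xs t

toExp : ℕ → List ℕ → Exp
toExp k xs i = if k ≤ᵇ i then nth xs (i ∸ k) else 0

mons : ℕ → ℕ → ℕ → List (List ℕ)
mons k zero      w = if w ≡ᵇ 0 then [] ∷ [] else []
mons k (suc len) w =
  concatMap (λ α → map (α ∷_) (mons (suc k) len (w ∸ k * α)))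
            (filter (λ α → Data.Nat._≤?_ (k * α) w) (upTo (suc w)))

-- For k ≥ 1 the monomials of S_k of weight w only involve x_k … x_{k+w-1}.
monomials : ℕ → ℕ → List (List ℕ)
monomials k w = mons k w w

-- Membership of a monomial in the ideals L_k and L_k^ℓ (parameter r).
-- A monomial lies in a monomial ideal iff it is divisible by a generator;
-- divisibility is the pointwise ≤ of exponents.

isOdd : ℕ → Bool
isOdd i = (i % 2) ≡ᵇ 1

anyR : (ℕ → Bool) → ℕ → ℕ → Bool
anyR p a b = any (λ n → (a ≤ᵇ n) ∧ p n) (upTo (suc b))

-- some generator of L_k whose smallest variable index is i divides e
-- (i odd: x_i^2, x_i x_{i+1}^{r-1};
--  i even: x_i^{r-n1} x_{i+2}^{n1} (0≤n1≤r-1),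
--          x_i^{r-n2-1} x_{i+1} x_{i+2}^{n2} (0≤n2≤r-2))
genAt : ℕ → Exp → ℕ → Bool
genAt r e i =
  if isOdd i
  then ((2 ≤ᵇ e i) ∨ ((1 ≤ᵇ e i) ∧ ((r ∸ 1) ≤ᵇ e (suc i))))
  else (anyR (λ n₁ → ((r ∸ n₁) ≤ᵇ e i) ∧ (n₁ ≤ᵇ e (i + 2))) 0 (r ∸ 1)
        ∨ anyR (λ n₂ → ((r ∸ n₂ ∸ 1) ≤ᵇ e i) ∧ (1 ≤ᵇ e (suc i)) ∧ (n₂ ≤ᵇ e (i + 2)))
               0 (r ∸ 2))

-- e ∈ L_k, where e is supported on indices ≤ bound.  Every generator of L_k
-- has positive exponent on its smallest variable, so only generators with
-- smallest index in [k, bound] can divide e.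
inL : ℕ → ℕ → ℕ → Exp → Bool
inL r k bound e = anyR (genAt r e) k bound

inLℓeven : ℕ → ℕ → ℕ → ℕ → Exp → Bool
inLℓeven r ℓ k bound e =
  (ℓ ≤ᵇ e k)
  ∨ anyR (λ t → ((ℓ ∸ t) ≤ᵇ e k) ∧ (((r ∸ ℓ) + t) ≤ᵇ e (k + 2))) 1 (ℓ ∸ 1)
  ∨ anyR (λ t → ((ℓ ∸ t) ≤ᵇ e k) ∧ (1 ≤ᵇ e (suc k)) ∧ (((r ∸ ℓ) + t ∸ 1) ≤ᵇ e (k + 2)))
         1 (ℓ ∸ 1)
  ∨ inL r (suc k) bound e

inLℓ : ℕ → ℕ → ℕ → ℕ → Exp → Bool
inLℓ r ℓ k bound e =
  if isOdd k
  then ((2 ≤ᵇ e k) ∨ ((1 ≤ᵇ e k) ∧ ((ℓ ∸ 1) ≤ᵇ e (suc k))) ∨ inLℓeven r ℓ (suc k) bound e)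
  else inLℓeven r ℓ k bound e

-- HP^k_ℓ = HP(S_k / L_k^ℓ): the coefficient of q^w is the number of
-- standard monomials (monomials of S_k of weight w not in L_k^ℓ).

HP : ℕ → ℕ → ℕ → Series
HP r k ℓ w =
  length (filter (λ xs → Data.Bool._≟_ (inLℓ r ℓ k (k + w + 2) (toExp k xs)) false)
                 (monomials k w))

-- The series N^J_{i,j,(r-1)d+j}; Nrec r J i t j is the one with d = J+1+t.

Ninit : ℕ → ℕ → ℕ → ℕ → Series
Ninit r J i j =
  if suc j ≤ᵇ i then (qpow (2 * suc J * j ∸ 1) ⊕ qpow (2 * suc J * (j ∸ 1)))
  else if j ≡ᵇ i then qpow (2 * suc J * (j ∸ 1))
  else zeroS

Nrec : ℕ → ℕ → ℕ → ℕ → ℕ → Series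
Nrec r J i zero    j = Ninit r J i j
Nrec r J i (suc t) j =
  (qpow (2 * suc d * (j ∸ 1)) ⊛ ΣS (Nrec r J i t) (suc r ∸ j))
  ⊕ (qpow (2 * suc d * j ∸ 1) ⊛ ΣS (Nrec r J i t) (r ∸ j))
  where d = suc J + t

-- N r J i d j = N^J_{i,j,(r-1)d+j}, meaningful for d ≥ J+1, 1 ≤ j ≤ r
N : ℕ → ℕ → ℕ → ℕ → ℕ → Series
N r J i d j = Nrec r J i (d ∸ suc J) j

{-# OPTIONS --safe #-}
-- Write k = 2J+1.  A monomial x_k^a x_{k+1}^b m of S_k (m in S_{k+2}) lies outside L_k^ℓ
-- iff it avoids x_k^2, x_k x_{k+1}^{ℓ-1}, x_{k+1}^ℓ and m lies outside L_{k+2}^{r-b}, since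
-- (L_{k+1}^ℓ : x_{k+1}^b) ∩ S_{k+2} = L_{k+2}^{r-b} for b < ℓ.  So a ≤ 1, and counting by
-- weight gives
--   HP^k_ℓ = Σ_{b<ℓ} q^{(k+1)b} HP^{k+2}_{r-b} + Σ_{b<ℓ-1} q^{k+(k+1)b} HP^{k+2}_{r-b},
-- the theorem for d = J+1.  For d → d+1, expand each HP^{2d+1}_{r-m+1} on the right by this
-- identity (J := d) and collect the coefficient of HP^{2d+3}_{r-j+1}: it is exactly the
-- recursion defining N.
module Submission where

open import Defs
open import Data.Nat using (ℕ; zero; suc; _+_; _*_; _∸_; _≤_; _<_; _≤ᵇ_; _≡ᵇ_; z≤n; s≤s; s≤s⁻¹; _≤?_; >-nonZero)
open import Data.Nat.Properties
open import Algebra.Properties.CommutativeSemigroup +-commutativeSemigroup using (interchange)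
open import Data.Nat.DivMod using (_%_; [m+kn]%n≡m%n)
open import Data.Bool using (Bool; true; false; _∧_; _∨_; not; if_then_else_)
import Data.Bool
open import Data.Bool.Properties using (not-involutive; ¬-not; if-eta; T-≡; T-∧; ∨-zeroʳ; ∨-identityʳ; ∨-assoc)
open import Data.List using (List; []; _∷_; map; concatMap; filter; length; upTo; _++_)
open import Data.List.Properties using (upTo-∷ʳ; map-++)
open import Data.Nat.ListAction using (sum)
open import Data.Nat.ListAction.Properties using (sum-++)
open import Data.List.Membership.Propositional using (find; lose)
open import Data.List.Membership.Propositional.Properties using (∈-upTo⁺; ∈-upTo⁻)
open import Data.List.Relation.Unary.Any.Properties using (any⁺; any⁻)
open import Function.Bundles using (Equivalence)
open import Data.List.Relation.Unary.All as All using (All; []; _∷_)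
open import Data.List.Relation.Unary.All.Properties using (concat⁺; map⁺)
open import Data.Product using (∃; _×_; _,_; proj₁; proj₂)
open import Data.Sum using (_⊎_; inj₁; inj₂)
open import Relation.Binary.PropositionalEquality
open import Relation.Binary.Definitions using (tri<; tri≈; tri>)
open import Relation.Nullary using (yes; no; ¬_; contradiction)

cong₃ : ∀ {A B C D : Set} (f : A → B → C → D) {a a′ b b′ c c′} → a ≡ a′ → b ≡ b′ → c ≡ c′ → f a b c ≡ f a′ b′ c′
cong₃ f refl refl refl = refl

true-iff⇒≡ : ∀ {x y : Bool} → (x ≡ true → y ≡ true) → (y ≡ true → x ≡ true) → x ≡ y
true-iff⇒≡ {false} {false} f g = refl
true-iff⇒≡ {false} {true}  f g = g refl
true-iff⇒≡ {true}  {false} f g = sym (f refl)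
true-iff⇒≡ {true}  {true}  f g = refl

∨-true⁻ : ∀ {x y : Bool} → x ∨ y ≡ true → x ≡ true ⊎ y ≡ true
∨-true⁻ {true}  p = inj₁ refl
∨-true⁻ {false} p = inj₂ p

∨-trueˡ : ∀ {x : Bool} (y : Bool) → x ≡ true → x ∨ y ≡ true
∨-trueˡ y refl = refl

∨-trueʳ : ∀ (x : Bool) {y : Bool} → y ≡ true → x ∨ y ≡ true
∨-trueʳ true  p = refl
∨-trueʳ false p = p

∧-true⁻ : ∀ {x y : Bool} → x ∧ y ≡ true → x ≡ true × y ≡ true
∧-true⁻ {true} {true} p = refl , refl

∧-true⁺ : ∀ {x y : Bool} → x ≡ true → y ≡ true → x ∧ y ≡ true
∧-true⁺ refl refl = refl

≤ᵇ≡true⇒≤ : ∀ {m n} → (m ≤ᵇ n) ≡ true → m ≤ n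
≤ᵇ≡true⇒≤ {m} {n} p = ≤ᵇ⇒≤ m n (Equivalence.from T-≡ p)

≤⇒≤ᵇ≡true : ∀ {m n} → m ≤ n → (m ≤ᵇ n) ≡ true
≤⇒≤ᵇ≡true p = Equivalence.to T-≡ (≤⇒≤ᵇ p)

>⇒≤ᵇ≡false : ∀ {m n} → n < m → (m ≤ᵇ n) ≡ false
>⇒≤ᵇ≡false p = ¬-not (λ q → <⇒≱ p (≤ᵇ≡true⇒≤ q))

≡⇒≡ᵇ≡true : ∀ {m n} → m ≡ n → (m ≡ᵇ n) ≡ true
≡⇒≡ᵇ≡true {m} {n} p = Equivalence.to T-≡ (≡⇒≡ᵇ m n p)

≢⇒≡ᵇ≡false : ∀ {m n} → ¬ m ≡ n → (m ≡ᵇ n) ≡ false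
≢⇒≡ᵇ≡false {m} {n} p = ¬-not (λ q → p (≡ᵇ⇒≡ m n (Equivalence.from T-≡ q)))

suc≤ᵇ∨≡ᵇ : ∀ j ℓ → (suc j ≤ᵇ ℓ) ∨ (j ≡ᵇ ℓ) ≡ (j ≤ᵇ ℓ)
suc≤ᵇ∨≡ᵇ j ℓ with <-cmp j ℓ
... | tri< j<ℓ _ _ rewrite ≤⇒≤ᵇ≡true {suc j} {ℓ} j<ℓ | ≤⇒≤ᵇ≡true (<⇒≤ j<ℓ) = refl
... | tri≈ _ refl _ rewrite >⇒≤ᵇ≡false {suc j} {j} ≤-refl | ≡⇒≡ᵇ≡true {j} {j} refl
                          | ≤⇒≤ᵇ≡true {j} {j} ≤-refl = refl
... | tri> _ _ ℓ<j rewrite >⇒≤ᵇ≡false {suc j} {ℓ} (<-trans ℓ<j (n<1+n j))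
                         | ≢⇒≡ᵇ≡false {j} {ℓ} (λ q → <⇒≢ ℓ<j (sym q)) | >⇒≤ᵇ≡false {j} {ℓ} ℓ<j = refl

anyR⁻ : ∀ {p : ℕ → Bool} {a b} → anyR p a b ≡ true → ∃ λ n → a ≤ n × n ≤ b × p n ≡ true
anyR⁻ {p} {a} {b} h with find (any⁻ _ (upTo (suc b)) (Equivalence.from T-≡ h))
... | n , n∈ , q with Equivalence.to T-∧ q
...   | a≤ᵇn , pn = n , ≤ᵇ⇒≤ a n a≤ᵇn , s≤s⁻¹ (∈-upTo⁻ n∈) , Equivalence.to T-≡ pn

anyR⁺ : ∀ {p : ℕ → Bool} {a b} n → a ≤ n → n ≤ b → p n ≡ true → anyR p a b ≡ true
anyR⁺ {p} {a} {b} n a≤n n≤b pn = Equivalence.to T-≡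
  (any⁺ _ (lose (∈-upTo⁺ (s≤s n≤b)) (Equivalence.from T-∧ (≤⇒≤ᵇ a≤n , Equivalence.from T-≡ pn))))

anyR-false : ∀ {p : ℕ → Bool} {a b} → (∀ n → a ≤ n → n ≤ b → p n ≡ false) → anyR p a b ≡ false
anyR-false {p} {a} {b} h = ¬-not λ q →
  let (n , a≤n , n≤b , pn) = anyR⁻ {p} {a} {b} q in contradiction (trans (sym pn) (h n a≤n n≤b)) λ ()

anyR-cong : ∀ {p p′ : ℕ → Bool} {a b} → (∀ n → a ≤ n → p n ≡ p′ n) → anyR p a b ≡ anyR p′ a b
anyR-cong {p} {p′} {a} {b} h = true-iff⇒≡
  (λ q → let (n , a≤n , n≤b , pn) = anyR⁻ {p} {a} {b} q in anyR⁺ {p′} {a} {b} n a≤n n≤b (trans (sym (h n a≤n)) pn))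
  (λ q → let (n , a≤n , n≤b , pn) = anyR⁻ {p′} {a} {b} q in anyR⁺ {p} {a} {b} n a≤n n≤b (trans (h n a≤n) pn))

anyR-unfold : ∀ (p : ℕ → Bool) a b → a ≤ b → anyR p a b ≡ p a ∨ anyR p (suc a) b
anyR-unfold p a b a≤b = true-iff⇒≡ to from
  where
  to : anyR p a b ≡ true → p a ∨ anyR p (suc a) b ≡ true
  to h with anyR⁻ {p} {a} {b} h
  ... | n , a≤n , n≤b , pn with m≤n⇒m<n∨m≡n a≤n
  ...   | inj₂ refl = ∨-trueˡ _ pn
  ...   | inj₁ a<n  = ∨-trueʳ (p a) (anyR⁺ {p} {suc a} {b} n a<n n≤b pn)
  from : p a ∨ anyR p (suc a) b ≡ true → anyR p a b ≡ true
  from h with ∨-true⁻ {p a} {anyR p (suc a) b} h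
  ... | inj₁ pa = anyR⁺ {p} {a} {b} a ≤-refl a≤b pa
  ... | inj₂ q with anyR⁻ {p} {suc a} {b} q
  ...   | n , a<n , n≤b , pn = anyR⁺ {p} {a} {b} n (<⇒≤ a<n) n≤b pn

open ≡-Reasoning

-- Finite sums over 0 … n-1 (ΣS of Defs runs over 1 … n)

sumTo : (ℕ → ℕ) → ℕ → ℕ
sumTo f zero    = 0
sumTo f (suc n) = sumTo f n + f n

sumTo-cong : ∀ {f g : ℕ → ℕ} n → (∀ x → x < n → f x ≡ g x) → sumTo f n ≡ sumTo g n
sumTo-cong zero    h = refl
sumTo-cong (suc n) h = cong₂ _+_ (sumTo-cong n (λ x x<n → h x (m≤n⇒m≤1+n x<n))) (h n ≤-refl)

sumTo-≡0 : ∀ {f : ℕ → ℕ} n → (∀ x → x < n → f x ≡ 0) → sumTo f n ≡ 0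
sumTo-≡0 zero    h = refl
sumTo-≡0 (suc n) h rewrite sumTo-≡0 n (λ x x<n → h x (m≤n⇒m≤1+n x<n)) | h n ≤-refl = refl

sumTo-vanishing : ∀ {f : ℕ → ℕ} n k → (∀ x → n ≤ x → f x ≡ 0) → sumTo f (n + k) ≡ sumTo f n
sumTo-vanishing n zero    h rewrite +-identityʳ n = refl
sumTo-vanishing n (suc k) h rewrite +-suc n k | sumTo-vanishing n k h | h (n + k) (m≤m+n n k) =
  +-identityʳ _

sumTo-cutoff : ∀ {f : ℕ → ℕ} n m → (∀ x → n ≤ x → f x ≡ 0) → (∀ x → m ≤ x → f x ≡ 0) →
               sumTo f n ≡ sumTo f m
sumTo-cutoff {f} n m hn hm with ≤-total n m
... | inj₁ n≤m = trans (sym (sumTo-vanishing n (m ∸ n) hn)) (cong (sumTo f) (m+[n∸m]≡n n≤m))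
... | inj₂ m≤n = trans (cong (sumTo f) (sym (m+[n∸m]≡n m≤n))) (sumTo-vanishing m (n ∸ m) hm)

sumTo-+ : ∀ (f g : ℕ → ℕ) n → sumTo (λ x → f x + g x) n ≡ sumTo f n + sumTo g n
sumTo-+ f g zero    = refl
sumTo-+ f g (suc n) rewrite sumTo-+ f g n = interchange (sumTo f n) (sumTo g n) (f n) (g n)

sumTo-swap : ∀ (h : ℕ → ℕ → ℕ) n m →
             sumTo (λ x → sumTo (λ y → h x y) m) n ≡ sumTo (λ y → sumTo (λ x → h x y) n) m
sumTo-swap h zero    m = sym (sumTo-≡0 m (λ _ _ → refl))
sumTo-swap h (suc n) m rewrite sumTo-swap h n m =
  sym (sumTo-+ (λ y → sumTo (λ x → h x y) n) (λ y → h n y) m)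

sumTo-if< : ∀ (g : ℕ → ℕ) c n → c ≤ n → sumTo (λ x → if suc x ≤ᵇ c then g x else 0) n ≡ sumTo g c
sumTo-if< g c n c≤n = begin
  sumTo g<c n ≡⟨ sumTo-cutoff n c (λ x n≤x → vanishes x (≤-trans c≤n n≤x)) vanishes ⟩
  sumTo g<c c ≡⟨ sumTo-cong c (λ x x<c → cong (λ b → if b then g x else 0) (≤⇒≤ᵇ≡true x<c)) ⟩
  sumTo g c   ∎
  where
  g<c : ℕ → ℕ
  g<c x = if suc x ≤ᵇ c then g x else 0
  vanishes : ∀ x → c ≤ x → g<c x ≡ 0
  vanishes x c≤x rewrite >⇒≤ᵇ≡false {suc x} {c} (s≤s c≤x) = refl

ΣS-sumTo : ∀ (f : ℕ → Series) n w → ΣS f n w ≡ sumTo (λ j → f (suc j) w) n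
ΣS-sumTo f zero    w = refl
ΣS-sumTo f (suc n) w rewrite ΣS-sumTo f n w = refl

sum-map-upTo : ∀ (g : ℕ → ℕ) n → sum (map g (upTo n)) ≡ sumTo g n
sum-map-upTo g zero    = refl
sum-map-upTo g (suc n) = begin
  sum (map g (upTo (suc n)))           ≡⟨ cong (λ l → sum (map g l)) (sym (upTo-∷ʳ n)) ⟩
  sum (map g (upTo n ++ n ∷ []))       ≡⟨ cong sum (map-++ g (upTo n) (n ∷ [])) ⟩
  sum (map g (upTo n) ++ g n ∷ [])     ≡⟨ sum-++ (map g (upTo n)) (g n ∷ []) ⟩
  sum (map g (upTo n)) + (g n + 0)     ≡⟨ cong₂ _+_ (sum-map-upTo g n) (+-identityʳ (g n)) ⟩
  sumTo g n + g n                      ∎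

shift : ℕ → Series → Series
shift a f n = if a ≤ᵇ n then f (n ∸ a) else 0

shift-cong : ∀ a {f g : Series} n → (∀ x → f x ≡ g x) → shift a f n ≡ shift a g n
shift-cong a n h with a ≤ᵇ n
... | true  = h (n ∸ a)
... | false = refl

shift-sumTo : ∀ a (g : ℕ → Series) c n →
              shift a (λ k → sumTo (λ m → g m k) c) n ≡ sumTo (λ m → shift a (g m) n) c
shift-sumTo a g c n with a ≤ᵇ n
... | true  = refl
... | false = sym (sumTo-≡0 c (λ _ _ → refl))

shift-+ : ∀ k x (f : Series) w → k ≤ w → (if x ≤ᵇ w ∸ k then f (w ∸ k ∸ x) else 0) ≡ shift (k + x) f w
shift-+ k x f w k≤w = trans (cong (λ z → if x ≤ᵇ w ∸ k then f z else 0) (∸-+-assoc w k x))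
  (cong (λ b → if b then f (w ∸ (k + x)) else 0) (true-iff⇒≡
     (λ p → ≤⇒≤ᵇ≡true (subst (_≤ w) (+-comm x k) (m≤o∸n⇒m+n≤o x k≤w (≤ᵇ≡true⇒≤ p))))
     (λ p → ≤⇒≤ᵇ≡true (m+n≤o⇒m≤o∸n x (subst (_≤ w) (+-comm k x) (≤ᵇ≡true⇒≤ p))))))

qpow-⊛ : ∀ a f n → (qpow a ⊛ f) n ≡ shift a f n
qpow-⊛ a f n = convAux-qpow a n ≤-refl
  where
  convAux-qpow : ∀ a m → m ≤ n → convAux (qpow a) f n m ≡ (if a ≤ᵇ m then f (n ∸ a) else 0)
  convAux-qpow zero    zero _ = +-identityʳ (f n)
  convAux-qpow (suc a) zero _ = refl
  convAux-qpow a (suc m) m<n with <-cmp a (suc m)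
  ... | tri< a<sm _ _ rewrite convAux-qpow a m (<⇒≤ m<n) | ≢⇒≡ᵇ≡false {a} {suc m} (<⇒≢ a<sm)
                            | ≤⇒≤ᵇ≡true (s≤s⁻¹ a<sm) | ≤⇒≤ᵇ≡true (<⇒≤ a<sm) = refl
  ... | tri≈ _ refl _ rewrite convAux-qpow (suc m) m (<⇒≤ m<n) | ≡⇒≡ᵇ≡true {suc m} {suc m} refl
                            | >⇒≤ᵇ≡false {suc m} {m} ≤-refl | ≤⇒≤ᵇ≡true {suc m} {suc m} ≤-refl =
    trans (+-identityʳ _) (+-identityʳ _)
  ... | tri> _ _ a>sm rewrite convAux-qpow a m (<⇒≤ m<n) | ≢⇒≡ᵇ≡false {a} {suc m} (λ e → <⇒≢ a>sm (sym e))
                            | >⇒≤ᵇ≡false {a} {m} (<-trans (n<1+n _) a>sm) | >⇒≤ᵇ≡false {a} {suc m} a>sm = refl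

⊛-cong : ∀ {f f′ g g′ : Series} n → (∀ x → f x ≡ f′ x) → (∀ x → g x ≡ g′ x) → (f ⊛ g) n ≡ (f′ ⊛ g′) n
⊛-cong {f} {f′} {g} {g′} n hf hg = convAux-cong n
  where
  convAux-cong : ∀ m → convAux f g n m ≡ convAux f′ g′ n m
  convAux-cong zero    = cong₂ _*_ (hf 0) (hg n)
  convAux-cong (suc m) = cong₂ _+_ (cong₂ _*_ (hf (suc m)) (hg (n ∸ suc m))) (convAux-cong m)

⊛-distribˡ-⊕ : ∀ f g h n → (f ⊛ (g ⊕ h)) n ≡ (f ⊛ g) n + (f ⊛ h) n
⊛-distribˡ-⊕ f g h n = convAux-distribˡ n
  where
  convAux-distribˡ : ∀ m → convAux f (g ⊕ h) n m ≡ convAux f g n m + convAux f h n m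
  convAux-distribˡ zero    = *-distribˡ-+ (f 0) (g n) (h n)
  convAux-distribˡ (suc m) rewrite convAux-distribˡ m | *-distribˡ-+ (f (suc m)) (g (n ∸ suc m)) (h (n ∸ suc m)) =
    interchange (f (suc m) * g (n ∸ suc m)) (f (suc m) * h (n ∸ suc m)) (convAux f g n m) (convAux f h n m)

⊛-distribʳ-⊕ : ∀ f g h n → ((f ⊕ g) ⊛ h) n ≡ (f ⊛ h) n + (g ⊛ h) n
⊛-distribʳ-⊕ f g h n = convAux-distribʳ n
  where
  convAux-distribʳ : ∀ m → convAux (f ⊕ g) h n m ≡ convAux f h n m + convAux g h n m
  convAux-distribʳ zero    = *-distribʳ-+ (h n) (f 0) (g 0)
  convAux-distribʳ (suc m) rewrite convAux-distribʳ m | *-distribʳ-+ (h (n ∸ suc m)) (f (suc m)) (g (suc m)) =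
    interchange (f (suc m) * h (n ∸ suc m)) (g (suc m) * h (n ∸ suc m)) (convAux f h n m) (convAux g h n m)

convAux-≡0 : ∀ f g n m → (∀ x → x ≤ m → f x * g (n ∸ x) ≡ 0) → convAux f g n m ≡ 0
convAux-≡0 f g n zero    h = h 0 z≤n
convAux-≡0 f g n (suc m) h rewrite h (suc m) ≤-refl = convAux-≡0 f g n m (λ x x≤m → h x (m≤n⇒m≤1+n x≤m))

⊛-zeroʳ : ∀ f n → (f ⊛ zeroS) n ≡ 0
⊛-zeroʳ f n = convAux-≡0 f zeroS n n (λ x _ → *-zeroʳ (f x))

⊛-zeroˡ : ∀ g n → (zeroS ⊛ g) n ≡ 0
⊛-zeroˡ g n = convAux-≡0 zeroS g n n (λ _ _ → refl)

⊛-distribˡ-ΣS : ∀ f (g : ℕ → Series) c n → (f ⊛ ΣS g c) n ≡ ΣS (λ j → f ⊛ g j) c n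
⊛-distribˡ-ΣS f g zero    n = ⊛-zeroʳ f n
⊛-distribˡ-ΣS f g (suc c) n =
  trans (⊛-distribˡ-⊕ f (ΣS g c) (g (suc c)) n) (cong (_+ (f ⊛ g (suc c)) n) (⊛-distribˡ-ΣS f g c n))

⊛-distribʳ-ΣS : ∀ (f : ℕ → Series) h c n → (ΣS f c ⊛ h) n ≡ ΣS (λ j → f j ⊛ h) c n
⊛-distribʳ-ΣS f h zero    n = ⊛-zeroˡ h n
⊛-distribʳ-ΣS f h (suc c) n =
  trans (⊛-distribʳ-⊕ (ΣS f c) (f (suc c)) h n) (cong (_+ (f (suc c) ⊛ h) n) (⊛-distribʳ-ΣS f h c n))

shift-⊛ : ∀ a f h n → (shift a f ⊛ h) n ≡ shift a (f ⊛ h) n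
shift-⊛ a f h n = convAux-shift a n ≤-refl
  where
  convAux-shift : ∀ a m → m ≤ n → convAux (shift a f) h n m ≡ (if a ≤ᵇ m then convAux f h (n ∸ a) (m ∸ a) else 0)
  convAux-shift zero    zero _ = refl
  convAux-shift (suc a) zero _ = refl
  convAux-shift a (suc m) m<n with <-cmp a (suc m)
  ... | tri< a<sm _ _ = begin
      shift a f (suc m) * h (n ∸ suc m) + convAux (shift a f) h n m
        ≡⟨ cong₂ _+_ (cong (λ b → (if b then f (suc m ∸ a) else 0) * h (n ∸ suc m)) (≤⇒≤ᵇ≡true (<⇒≤ a<sm)))
                     (trans (convAux-shift a m (<⇒≤ m<n))
                            (cong (λ b → if b then convAux f h (n ∸ a) (m ∸ a) else 0) (≤⇒≤ᵇ≡true a≤m))) ⟩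
      f (suc m ∸ a) * h (n ∸ suc m) + convAux f h (n ∸ a) (m ∸ a)
        ≡⟨ cong₂ _+_ (cong₂ _*_ (cong f sm∸a) (cong h n∸sm)) refl ⟩
      f (suc (m ∸ a)) * h (n ∸ a ∸ suc (m ∸ a)) + convAux f h (n ∸ a) (m ∸ a)
        ≡⟨ cong (convAux f h (n ∸ a)) (sym sm∸a) ⟩
      convAux f h (n ∸ a) (suc m ∸ a)
        ≡⟨ cong (λ b → if b then convAux f h (n ∸ a) (suc m ∸ a) else 0) (sym (≤⇒≤ᵇ≡true (<⇒≤ a<sm))) ⟩
      (if a ≤ᵇ suc m then convAux f h (n ∸ a) (suc m ∸ a) else 0) ∎
    where
    a≤m : a ≤ m
    a≤m = s≤s⁻¹ a<sm
    sm∸a : suc m ∸ a ≡ suc (m ∸ a)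
    sm∸a = +-∸-assoc 1 a≤m
    n∸sm : n ∸ suc m ≡ n ∸ a ∸ suc (m ∸ a)
    n∸sm = sym (trans (∸-+-assoc n a (suc (m ∸ a))) (cong (n ∸_) (trans (+-suc a (m ∸ a)) (cong suc (m+[n∸m]≡n a≤m)))))
  ... | tri≈ _ refl _ rewrite convAux-shift (suc m) m (<⇒≤ m<n) | >⇒≤ᵇ≡false {suc m} {m} ≤-refl
                            | ≤⇒≤ᵇ≡true {suc m} {suc m} ≤-refl | n∸n≡0 m = +-identityʳ _
  ... | tri> _ _ a>sm rewrite convAux-shift a m (<⇒≤ m<n) | >⇒≤ᵇ≡false {a} {m} (<-trans (n<1+n _) a>sm)
                            | >⇒≤ᵇ≡false {a} {suc m} a>sm = refl

⊛-shift : ∀ a f h n → (f ⊛ shift a h) n ≡ shift a (f ⊛ h) n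
⊛-shift a f h n with a ≤? n
... | yes a≤n rewrite ≤⇒≤ᵇ≡true a≤n =
  trans (convAux-truncate n (m∸n≤m n a) vanishes) (convAux-unshift (n ∸ a) ≤-refl)
  where
  n∸x<a : ∀ x → n ∸ a < x → x ≤ n → n ∸ x < a
  n∸x<a x n∸a<x x≤n = subst (_≤ a) (+-∸-assoc 1 x≤n) (subst (suc n ∸ x ≤_) (m+n∸n≡m a x) (∸-monoˡ-≤ x
            (≤-trans (s≤s (m≤n+m∸n n a)) (subst (_≤ a + x) (+-suc a (n ∸ a)) (+-monoʳ-≤ a n∸a<x)))))
  vanishes : ∀ x → n ∸ a < x → x ≤ n → f x * shift a h (n ∸ x) ≡ 0
  vanishes x n∸a<x x≤n rewrite >⇒≤ᵇ≡false {a} {n ∸ x} (n∸x<a x n∸a<x x≤n) = *-zeroʳ (f x)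
  convAux-truncate : ∀ m {m′} → m′ ≤ m → (∀ x → m′ < x → x ≤ m → f x * shift a h (n ∸ x) ≡ 0) →
                     convAux f (shift a h) n m ≡ convAux f (shift a h) n m′
  convAux-truncate m m′≤m hv with m≤n⇒m<n∨m≡n m′≤m
  ... | inj₂ refl = refl
  convAux-truncate (suc m) m′≤m hv | inj₁ m′<sm rewrite hv (suc m) m′<sm ≤-refl =
    convAux-truncate m (s≤s⁻¹ m′<sm) (λ x m′<x x≤m → hv x m′<x (m≤n⇒m≤1+n x≤m))
  a≤n∸sm : ∀ m → suc m ≤ n ∸ a → a ≤ n ∸ suc m
  a≤n∸sm m sm≤n∸a = m+n≤o⇒m≤o∸n a (subst (_≤ n) (+-comm (suc m) a) (m≤o∸n⇒m+n≤o (suc m) a≤n sm≤n∸a))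
  convAux-unshift : ∀ m → m ≤ n ∸ a → convAux f (shift a h) n m ≡ convAux f h (n ∸ a) m
  convAux-unshift zero _ rewrite ≤⇒≤ᵇ≡true a≤n = refl
  convAux-unshift (suc m) sm≤n∸a rewrite convAux-unshift m (<⇒≤ sm≤n∸a) | ≤⇒≤ᵇ≡true (a≤n∸sm m sm≤n∸a) =
    cong (λ z → f (suc m) * h z + convAux f h (n ∸ a) m)
         (trans (∸-+-assoc n (suc m) a) (trans (cong (n ∸_) (+-comm (suc m) a)) (sym (∸-+-assoc n a (suc m)))))
... | no a≰n rewrite >⇒≤ᵇ≡false {a} {n} (≰⇒> a≰n) =
  convAux-≡0 f (shift a h) n n (λ x _ → trans (cong (f x *_) (vanishes x)) (*-zeroʳ (f x)))
  where
  vanishes : ∀ x → shift a h (n ∸ x) ≡ 0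
  vanishes x rewrite >⇒≤ᵇ≡false {a} {n ∸ x} (≤-<-trans (m∸n≤m n x) (≰⇒> a≰n)) = refl

qpow⊛ΣS-⊛ : ∀ a (F : ℕ → Series) c (H : Series) w →
            ((qpow a ⊛ ΣS F c) ⊛ H) w ≡ sumTo (λ m → shift a (F (suc m) ⊛ H) w) c
qpow⊛ΣS-⊛ a F c H w = begin
  ((qpow a ⊛ ΣS F c) ⊛ H) w                    ≡⟨ ⊛-cong w (qpow-⊛ a (ΣS F c)) (λ _ → refl) ⟩
  (shift a (ΣS F c) ⊛ H) w                     ≡⟨ shift-⊛ a (ΣS F c) H w ⟩
  shift a (ΣS F c ⊛ H) w                       ≡⟨ shift-cong a w (λ x → trans (⊛-distribʳ-ΣS F H c x)
                                                                              (ΣS-sumTo (λ j → F j ⊛ H) c x)) ⟩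
  shift a (λ x → sumTo (λ m → (F (suc m) ⊛ H) x) c) w ≡⟨ shift-sumTo a (λ m → F (suc m) ⊛ H) c w ⟩
  sumTo (λ m → shift a (F (suc m) ⊛ H) w) c    ∎

-- Ninit r J ℓ j is definitionally of this form.

twoTerm : Bool → Bool → ℕ → ℕ → Series
twoTerm b₁ b₂ A B = if b₁ then qpow B ⊕ qpow A else if b₂ then qpow A else zeroS

twoTerm-⊛ : ∀ b₁ b₂ A B (H : Series) w →
  (twoTerm b₁ b₂ A B ⊛ H) w ≡ (if b₁ then shift B H w else 0) + (if b₁ ∨ b₂ then shift A H w else 0)
twoTerm-⊛ true  b₂    A B H w = trans (⊛-distribʳ-⊕ (qpow B) (qpow A) H w) (cong₂ _+_ (qpow-⊛ B H w) (qpow-⊛ A H w))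
twoTerm-⊛ false true  A B H w = qpow-⊛ A H w
twoTerm-⊛ false false A B H w = ⊛-zeroˡ H w

⊛-twoTerm-⊛ : ∀ b₁ b₂ A B (F H : Series) w →
  (F ⊛ (twoTerm b₁ b₂ A B ⊛ H)) w
  ≡ (if b₁ then shift B (F ⊛ H) w else 0) + (if b₁ ∨ b₂ then shift A (F ⊛ H) w else 0)
⊛-twoTerm-⊛ true b₂ A B F H w = begin
  (F ⊛ ((qpow B ⊕ qpow A) ⊛ H)) w
    ≡⟨ ⊛-cong w (λ _ → refl) (λ x → trans (⊛-distribʳ-⊕ (qpow B) (qpow A) H x)
                                          (cong₂ _+_ (qpow-⊛ B H x) (qpow-⊛ A H x))) ⟩
  (F ⊛ (shift B H ⊕ shift A H)) w
    ≡⟨ ⊛-distribˡ-⊕ F (shift B H) (shift A H) w ⟩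
  (F ⊛ shift B H) w + (F ⊛ shift A H) w
    ≡⟨ cong₂ _+_ (⊛-shift B F H w) (⊛-shift A F H w) ⟩
  shift B (F ⊛ H) w + shift A (F ⊛ H) w ∎
⊛-twoTerm-⊛ false true  A B F H w = trans (⊛-cong w (λ _ → refl) (qpow-⊛ A H)) (⊛-shift A F H w)
⊛-twoTerm-⊛ false false A B F H w = trans (⊛-cong w (λ _ → refl) (λ x → ⊛-zeroˡ H x)) (⊛-zeroʳ F w)

Ninit-⊛ : ∀ r J ℓ j (H : Series) w →
  (Ninit r J ℓ j ⊛ H) w ≡ (if suc j ≤ᵇ ℓ then shift (2 * suc J * j ∸ 1) H w else 0)
                        + (if j ≤ᵇ ℓ then shift (2 * suc J * (j ∸ 1)) H w else 0)
Ninit-⊛ r J ℓ j H w =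
  trans (twoTerm-⊛ (suc j ≤ᵇ ℓ) (j ≡ᵇ ℓ) (2 * suc J * (j ∸ 1)) (2 * suc J * j ∸ 1) H w)
        (cong (λ b → (if suc j ≤ᵇ ℓ then shift (2 * suc J * j ∸ 1) H w else 0)
                     + (if b then shift (2 * suc J * (j ∸ 1)) H w else 0)) (suc≤ᵇ∨≡ᵇ j ℓ))

⊛-Ninit-⊛ : ∀ r J ℓ j (F H : Series) w →
  (F ⊛ (Ninit r J ℓ j ⊛ H)) w ≡ (if suc j ≤ᵇ ℓ then shift (2 * suc J * j ∸ 1) (F ⊛ H) w else 0)
                              + (if j ≤ᵇ ℓ then shift (2 * suc J * (j ∸ 1)) (F ⊛ H) w else 0)
⊛-Ninit-⊛ r J ℓ j F H w =
  trans (⊛-twoTerm-⊛ (suc j ≤ᵇ ℓ) (j ≡ᵇ ℓ) (2 * suc J * (j ∸ 1)) (2 * suc J * j ∸ 1) F H w)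
        (cong (λ b → (if suc j ≤ᵇ ℓ then shift (2 * suc J * j ∸ 1) (F ⊛ H) w else 0)
                     + (if b then shift (2 * suc J * (j ∸ 1)) (F ⊛ H) w else 0)) (suc≤ᵇ∨≡ᵇ j ℓ))

≤ᵇ∸-complement : ∀ {M ℓ s} j → 1 ≤ M → ℓ + M ≡ s → (M ≤ᵇ s ∸ j) ≡ (j ≤ᵇ ℓ)
≤ᵇ∸-complement {M} {ℓ} {s} j 1≤M ℓ+M≡s = true-iff⇒≡
  (λ p → let M≤s∸j = ≤ᵇ≡true⇒≤ p
             j≤s   = <⇒≤ (m∸n≢0⇒n<m {s} {j} (λ s∸j≡0 → contradiction (subst (M ≤_) s∸j≡0 M≤s∸j) (<⇒≱ 1≤M)))
         in ≤⇒≤ᵇ≡true (+-cancelʳ-≤ M j ℓ (subst (j + M ≤_) (sym ℓ+M≡s)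
                         (subst (_≤ s) (+-comm M j) (m≤o∸n⇒m+n≤o M j≤s M≤s∸j)))))
  (λ p → ≤⇒≤ᵇ≡true (m+n≤o⇒m≤o∸n M (subst (_≤ s) (+-comm j M)
                      (subst (j + M ≤_) ℓ+M≡s (+-monoˡ-≤ M (≤ᵇ≡true⇒≤ p))))))

InitialExpansion : ℕ → Set
InitialExpansion r = ∀ J ℓ → 1 ≤ ℓ → ℓ ≤ r → ∀ w →
  HP r (2 * J + 1) ℓ w ≡ ΣS (λ j → Ninit r J ℓ j ⊛ HP r (2 * suc J + 1) (suc r ∸ j)) r w

module Propagation (r J i : ℕ) (initial : InitialExpansion r) (t w : ℕ) where
  private
    d : ℕ
    d = suc J + t

    Nₜ Nₜ₊₁ : ℕ → Series
    Nₜ   = Nrec r J i t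
    Nₜ₊₁ = Nrec r J i (suc t)

    HPd HPd+1 : ℕ → Series
    HPd   m = HP r (2 * d + 1) (suc r ∸ m)
    HPd+1 j = HP r (2 * suc d + 1) (suc r ∸ j)

    A B : ℕ → ℕ
    A j = 2 * suc d * j
    B j = 2 * suc d * suc j ∸ 1

    contribution : ℕ → ℕ → ℕ
    contribution m j = (if suc m ≤ᵇ r ∸ suc j then shift (B j) (Nₜ (suc m) ⊛ HPd+1 (suc j)) w else 0)
                     + (if suc m ≤ᵇ r ∸ j then shift (A j) (Nₜ (suc m) ⊛ HPd+1 (suc j)) w else 0)

    expand : ∀ m → m < r → (Nₜ (suc m) ⊛ HPd (suc m)) w ≡ sumTo (contribution m) r
    expand m m<r = begin
      (Nₜ (suc m) ⊛ HPd (suc m)) w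
        ≡⟨ ⊛-cong w (λ _ → refl) (initial d (r ∸ m) (m<n⇒0<n∸m m<r) (m∸n≤m r m)) ⟩
      (Nₜ (suc m) ⊛ ΣS (λ j → Ninit r d (r ∸ m) j ⊛ HPd+1 j) r) w
        ≡⟨ ⊛-distribˡ-ΣS (Nₜ (suc m)) (λ j → Ninit r d (r ∸ m) j ⊛ HPd+1 j) r w ⟩
      ΣS (λ j → Nₜ (suc m) ⊛ (Ninit r d (r ∸ m) j ⊛ HPd+1 j)) r w
        ≡⟨ ΣS-sumTo _ r w ⟩
      sumTo (λ j → (Nₜ (suc m) ⊛ (Ninit r d (r ∸ m) (suc j) ⊛ HPd+1 (suc j))) w) r
        ≡⟨ sumTo-cong r (λ j _ → trans (⊛-Ninit-⊛ r d (r ∸ m) (suc j) (Nₜ (suc m)) (HPd+1 (suc j)) w)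
                                       (cong₂ (λ b₁ b₂ → (if b₁ then shift (B j) (F j) w else 0)
                                                       + (if b₂ then shift (A j) (F j) w else 0))
                                              (complement (suc (suc j))) (complement (suc j)))) ⟩
      sumTo (contribution m) r ∎
      where
      F : ℕ → Series
      F j = Nₜ (suc m) ⊛ HPd+1 (suc j)
      complement : ∀ j → (j ≤ᵇ r ∸ m) ≡ (suc m ≤ᵇ suc r ∸ j)
      complement j = sym (≤ᵇ∸-complement j (s≤s z≤n) (trans (+-suc (r ∸ m) m) (cong suc (m∸n+n≡m (<⇒≤ m<r)))))

    collect : ∀ j → sumTo (λ m → contribution m j) r ≡ (Nₜ₊₁ (suc j) ⊛ HPd+1 (suc j)) w
    collect j = begin
      sumTo (λ m → contribution m j) r
        ≡⟨ sumTo-+ _ _ r ⟩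
      sumTo (λ m → if suc m ≤ᵇ r ∸ suc j then shift (B j) (Nₜ (suc m) ⊛ H) w else 0) r
        + sumTo (λ m → if suc m ≤ᵇ r ∸ j then shift (A j) (Nₜ (suc m) ⊛ H) w else 0) r
        ≡⟨ cong₂ _+_ (sumTo-if< (λ m → shift (B j) (Nₜ (suc m) ⊛ H) w) (r ∸ suc j) r (m∸n≤m r (suc j)))
                     (sumTo-if< (λ m → shift (A j) (Nₜ (suc m) ⊛ H) w) (r ∸ j) r (m∸n≤m r j)) ⟩
      sumTo (λ m → shift (B j) (Nₜ (suc m) ⊛ H) w) (r ∸ suc j)
        + sumTo (λ m → shift (A j) (Nₜ (suc m) ⊛ H) w) (r ∸ j)
        ≡⟨ +-comm (sumTo (λ m → shift (B j) (Nₜ (suc m) ⊛ H) w) (r ∸ suc j)) _ ⟩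
      sumTo (λ m → shift (A j) (Nₜ (suc m) ⊛ H) w) (r ∸ j)
        + sumTo (λ m → shift (B j) (Nₜ (suc m) ⊛ H) w) (r ∸ suc j)
        ≡⟨ sym (cong₂ _+_ (qpow⊛ΣS-⊛ (A j) Nₜ (r ∸ j) H w) (qpow⊛ΣS-⊛ (B j) Nₜ (r ∸ suc j) H w)) ⟩
      ((qpow (A j) ⊛ ΣS Nₜ (r ∸ j)) ⊛ H) w + ((qpow (B j) ⊛ ΣS Nₜ (r ∸ suc j)) ⊛ H) w
        ≡⟨ sym (⊛-distribʳ-⊕ (qpow (A j) ⊛ ΣS Nₜ (r ∸ j)) (qpow (B j) ⊛ ΣS Nₜ (r ∸ suc j)) H w) ⟩
      (Nₜ₊₁ (suc j) ⊛ H) w ∎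
      where
      H = HPd+1 (suc j)

  step : ΣS (λ m → Nₜ m ⊛ HPd m) r w ≡ ΣS (λ j → Nₜ₊₁ j ⊛ HPd+1 j) r w
  step = begin
    ΣS (λ m → Nₜ m ⊛ HPd m) r w                   ≡⟨ ΣS-sumTo _ r w ⟩
    sumTo (λ m → (Nₜ (suc m) ⊛ HPd (suc m)) w) r  ≡⟨ sumTo-cong r expand ⟩
    sumTo (λ m → sumTo (contribution m) r) r      ≡⟨ sumTo-swap contribution r r ⟩
    sumTo (λ j → sumTo (λ m → contribution m j) r) r ≡⟨ sumTo-cong r (λ j _ → collect j) ⟩
    sumTo (λ j → (Nₜ₊₁ (suc j) ⊛ HPd+1 (suc j)) w) r ≡⟨ sym (ΣS-sumTo _ r w) ⟩
    ΣS (λ j → Nₜ₊₁ j ⊛ HPd+1 j) r w               ∎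

expansion : ∀ r J i → InitialExpansion r → 1 ≤ i → i ≤ r → ∀ t w →
  HP r (2 * J + 1) i w ≡ ΣS (λ j → Nrec r J i t j ⊛ HP r (2 * (suc J + t) + 1) (suc r ∸ j)) r w
expansion r J i initial 1≤i i≤r zero w =
  subst (λ D → HP r (2 * J + 1) i w ≡ ΣS (λ j → Ninit r J i j ⊛ HP r (2 * D + 1) (suc r ∸ j)) r w)
        (sym (+-identityʳ (suc J))) (initial J i 1≤i i≤r w)
expansion r J i initial 1≤i i≤r (suc t) w =
  subst (λ D → HP r (2 * J + 1) i w ≡ ΣS (λ j → Nrec r J i (suc t) j ⊛ HP r (2 * D + 1) (suc r ∸ j)) r w)
        (sym (+-suc (suc J) t))
        (trans (expansion r J i initial 1≤i i≤r t w) (Propagation.step r J i initial t w))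

-- Counting standard monomials

countFalse : {A : Set} → (A → Bool) → List A → ℕ
countFalse f []       = 0
countFalse f (x ∷ xs) = (if f x then 0 else 1) + countFalse f xs

length-filter-false : {A : Set} (f : A → Bool) (xs : List A) →
                      length (filter (λ x → Data.Bool._≟_ (f x) false) xs) ≡ countFalse f xs
length-filter-false f []       = refl
length-filter-false f (x ∷ xs) with f x
... | true  = length-filter-false f xs
... | false = cong suc (length-filter-false f xs)

countFalse-++ : {A : Set} (f : A → Bool) (xs ys : List A) →
                countFalse f (xs ++ ys) ≡ countFalse f xs + countFalse f ys
countFalse-++ f []       ys = refl
countFalse-++ f (x ∷ xs) ys rewrite countFalse-++ f xs ys = sym (+-assoc _ (countFalse f xs) (countFalse f ys))

countFalse-map : {A B : Set} (f : B → Bool) (g : A → B) (xs : List A) →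
                 countFalse f (map g xs) ≡ countFalse (λ x → f (g x)) xs
countFalse-map f g []       = refl
countFalse-map f g (x ∷ xs) rewrite countFalse-map f g xs = refl

countFalse-concatMap : {A B : Set} (f : B → Bool) (h : A → List B) (xs : List A) →
                       countFalse f (concatMap h xs) ≡ sum (map (λ x → countFalse f (h x)) xs)
countFalse-concatMap f h []       = refl
countFalse-concatMap f h (x ∷ xs) =
  trans (countFalse-++ f (h x) (concatMap h xs)) (cong (countFalse f (h x) +_) (countFalse-concatMap f h xs))

countFalse-congᴬ : {A : Set} {f g : A → Bool} (xs : List A) → All (λ x → f x ≡ g x) xs →
                   countFalse f xs ≡ countFalse g xs
countFalse-congᴬ []       []         = refl
countFalse-congᴬ (x ∷ xs) (fx≡gx ∷ h) rewrite fx≡gx = cong (_ +_) (countFalse-congᴬ xs h)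

countFalse-cong : {A : Set} {f g : A → Bool} (xs : List A) → f ≗ g → countFalse f xs ≡ countFalse g xs
countFalse-cong xs h = countFalse-congᴬ xs (All.tabulate (λ {x} _ → h x))

countFalse-∨ : {A : Set} (b : Bool) (g : A → Bool) (xs : List A) →
               countFalse (λ x → b ∨ g x) xs ≡ (if b then 0 else countFalse g xs)
countFalse-∨ true  g []       = refl
countFalse-∨ true  g (x ∷ xs) = countFalse-∨ true g xs
countFalse-∨ false g xs       = refl

sum-map-filter : ∀ (g : ℕ → ℕ) k w xs →
  sum (map g (filter (λ a → k * a ≤? w) xs)) ≡ sum (map (λ a → if k * a ≤ᵇ w then g a else 0) xs)
sum-map-filter g k w []       = refl
sum-map-filter g k w (x ∷ xs) with k * x ≤ᵇ w
... | true  = cong (g x +_) (sum-map-filter g k w xs)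
... | false = sum-map-filter g k w xs

mons-length : ∀ k len w → All (λ xs → length xs ≡ len) (mons k len w)
mons-length k zero w with w ≡ᵇ 0
... | true  = refl ∷ []
... | false = []
mons-length k (suc len) w =
  concat⁺ (map⁺ {xs = filter (λ α → k * α ≤? w) (upTo (suc w))} {f = λ α → map (α ∷_) (mons (suc k) len (w ∸ k * α))}
                (All.tabulate (λ {α} _ → map⁺ (All.map (cong suc) (mons-length (suc k) len (w ∸ k * α))))))

toExp-beyond : ∀ k xs i → k + length xs ≤ i → toExp k xs i ≡ 0
toExp-beyond k xs i k+len≤i rewrite ≤⇒≤ᵇ≡true {k} {i} (≤-trans (m≤m+n k (length xs)) k+len≤i) =
  nth-beyond xs (i ∸ k) (m+n≤o⇒m≤o∸n (length xs) (subst (_≤ i) (+-comm k (length xs)) k+len≤i))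
  where
  nth-beyond : ∀ xs j → length xs ≤ j → nth xs j ≡ 0
  nth-beyond []       j       _   = refl
  nth-beyond (x ∷ xs) (suc j) len≤ = nth-beyond xs j (s≤s⁻¹ len≤)

Extensional : (Exp → Bool) → Set
Extensional P = ∀ {e e′} → e ≗ e′ → P e ≡ P e′

setExp : ℕ → ℕ → Exp → Exp
setExp k α e i = if i ≡ᵇ k then α else e i

setExp-same : ∀ k α e → setExp k α e k ≡ α
setExp-same k α e = cong (λ b → if b then α else e k) (≡⇒≡ᵇ≡true {k} refl)

setExp-other : ∀ k α e {i} → i ≢ k → setExp k α e i ≡ e i
setExp-other k α e {i} i≢k = cong (λ b → if b then α else e i) (≢⇒≡ᵇ≡false i≢k)

_⟨_≔_⟩ : (Exp → Bool) → ℕ → ℕ → Exp → Bool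
(P ⟨ k ≔ α ⟩) e = P (setExp k α e)

⟨≔⟩-extensional : ∀ P k α → Extensional P → Extensional (P ⟨ k ≔ α ⟩)
⟨≔⟩-extensional P k α ext {e} {e′} e≗e′ = ext setExp≗
  where
  setExp≗ : setExp k α e ≗ setExp k α e′
  setExp≗ i with i ≡ᵇ k
  ... | true  = refl
  ... | false = e≗e′ i

toExp-∷ : ∀ k α xs → toExp k (α ∷ xs) ≗ setExp k α (toExp (suc k) xs)
toExp-∷ k α xs i with <-cmp i k
... | tri< i<k _ _ rewrite >⇒≤ᵇ≡false {k} {i} i<k | ≢⇒≡ᵇ≡false {i} {k} (<⇒≢ i<k)
                         | >⇒≤ᵇ≡false {suc k} {i} (m≤n⇒m≤1+n i<k) = refl
... | tri≈ _ refl _ rewrite ≤⇒≤ᵇ≡true {i} {i} ≤-refl | ≡⇒≡ᵇ≡true {i} {i} refl | n∸n≡0 i = refl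
toExp-∷ k α xs (suc i) | tri> _ _ k<si = begin
  (if k ≤ᵇ suc i then nth (α ∷ xs) (suc i ∸ k) else 0)
    ≡⟨ cong (λ b → if b then nth (α ∷ xs) (suc i ∸ k) else 0) (≤⇒≤ᵇ≡true (<⇒≤ k<si)) ⟩
  nth (α ∷ xs) (suc i ∸ k)
    ≡⟨ cong (nth (α ∷ xs)) (+-∸-assoc 1 (s≤s⁻¹ k<si)) ⟩
  nth xs (i ∸ k)
    ≡⟨ cong (λ b → if b then nth xs (i ∸ k) else 0) (sym (≤⇒≤ᵇ≡true k<si)) ⟩
  toExp (suc k) xs (suc i)
    ≡⟨ cong (λ b → if b then α else toExp (suc k) xs (suc i)) (sym (≢⇒≡ᵇ≡false {suc i} {k} (λ q → <⇒≢ k<si (sym q)))) ⟩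
  setExp k α (toExp (suc k) xs) (suc i) ∎

countOutside : (Exp → Bool) → ℕ → ℕ → ℕ → ℕ
countOutside P k len w = countFalse (λ xs → P (toExp k xs)) (mons k len w)

countOutside-suc : ∀ P k len w → Extensional P →
  countOutside P k (suc len) w
  ≡ sumTo (λ α → if k * α ≤ᵇ w then countOutside (P ⟨ k ≔ α ⟩) (suc k) len (w ∸ k * α) else 0) (suc w)
countOutside-suc P k len w ext = begin
  countOutside P k (suc len) w
    ≡⟨ countFalse-concatMap _ (λ α → map (α ∷_) (mons (suc k) len (w ∸ k * α))) weights ⟩
  sum (map (λ α → countFalse P′ (map (α ∷_) (mons (suc k) len (w ∸ k * α)))) weights)
    ≡⟨ sum-map-filter _ k w (upTo (suc w)) ⟩
  sum (map (λ α → if k * α ≤ᵇ w then countFalse P′ (map (α ∷_) (mons (suc k) len (w ∸ k * α))) else 0) (upTo (suc w)))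
    ≡⟨ sum-map-upTo _ (suc w) ⟩
  sumTo (λ α → if k * α ≤ᵇ w then countFalse P′ (map (α ∷_) (mons (suc k) len (w ∸ k * α))) else 0) (suc w)
    ≡⟨ sumTo-cong (suc w) (λ α _ → cong (λ z → if k * α ≤ᵇ w then z else 0)
         (trans (countFalse-map P′ (α ∷_) (mons (suc k) len (w ∸ k * α)))
                (countFalse-cong (mons (suc k) len (w ∸ k * α)) (λ ys → ext (toExp-∷ k α ys))))) ⟩
  sumTo (λ α → if k * α ≤ᵇ w then countOutside (P ⟨ k ≔ α ⟩) (suc k) len (w ∸ k * α) else 0) (suc w) ∎
  where
  P′ : List ℕ → Bool
  P′ xs = P (toExp k xs)
  weights : List ℕ
  weights = filter (λ α → k * α ≤? w) (upTo (suc w))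

countOutside-len-suc : ∀ len k w P → Extensional P → 1 ≤ k → w < k + len →
                       countOutside P k len w ≡ countOutside P k (suc len) w
countOutside-len-suc zero k w P ext 1≤k w<k+0 = begin
  countOutside P k 0 w
    ≡⟨ base w ⟩
  0 + G 0
    ≡⟨ sumTo-cutoff {G} 1 (suc w) G≡0 (λ x sw≤x → G≡0 x (≤-trans (s≤s z≤n) sw≤x)) ⟩
  sumTo G (suc w)
    ≡⟨ sym (countOutside-suc P k 0 w ext) ⟩
  countOutside P k 1 w ∎
  where
  G : ℕ → ℕ
  G α = if k * α ≤ᵇ w then countOutside (P ⟨ k ≔ α ⟩) (suc k) 0 (w ∸ k * α) else 0
  G≡0 : ∀ x → 1 ≤ x → G x ≡ 0
  G≡0 x 1≤x rewrite >⇒≤ᵇ≡false {k * x} {w}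
    (<-≤-trans (subst (w <_) (+-identityʳ k) w<k+0) (subst (_≤ k * x) (*-identityʳ k) (*-monoʳ-≤ k 1≤x))) = refl
  toExp-[] : toExp k [] ≗ setExp k 0 (toExp (suc k) [])
  toExp-[] i = trans (cong (λ z → if k ≤ᵇ i then z else 0) (nth-[0] (i ∸ k))) (toExp-∷ k 0 [] i)
    where
    nth-[0] : ∀ j → nth [] j ≡ nth (0 ∷ []) j
    nth-[0] zero    = refl
    nth-[0] (suc j) = refl
  base : ∀ v → countOutside P k 0 v ≡ 0 + (if k * 0 ≤ᵇ v then countOutside (P ⟨ k ≔ 0 ⟩) (suc k) 0 (v ∸ k * 0) else 0)
  base zero    rewrite *-zeroʳ k = cong (λ b → (if b then 0 else 1) + 0) (ext toExp-[])
  base (suc v) rewrite *-zeroʳ k = refl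
countOutside-len-suc (suc len) k w P ext 1≤k w<k+sl = begin
  countOutside P k (suc len) w
    ≡⟨ countOutside-suc P k len w ext ⟩
  sumTo (λ α → if k * α ≤ᵇ w then countOutside (P ⟨ k ≔ α ⟩) (suc k) len (w ∸ k * α) else 0) (suc w)
    ≡⟨ sumTo-cong (suc w) (λ α _ → cong (λ z → if k * α ≤ᵇ w then z else 0)
         (countOutside-len-suc len (suc k) (w ∸ k * α) (P ⟨ k ≔ α ⟩) (⟨≔⟩-extensional P k α ext) (s≤s z≤n)
            (≤-<-trans (m∸n≤m w (k * α)) (subst (w <_) (+-suc k len) w<k+sl)))) ⟩
  sumTo (λ α → if k * α ≤ᵇ w then countOutside (P ⟨ k ≔ α ⟩) (suc k) (suc len) (w ∸ k * α) else 0) (suc w)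
    ≡⟨ sym (countOutside-suc P k (suc len) w ext) ⟩
  countOutside P k (suc (suc len)) w ∎

countOutside-len : ∀ len len′ k w P → Extensional P → 1 ≤ k → w < k + len → len ≤ len′ →
                   countOutside P k len w ≡ countOutside P k len′ w
countOutside-len len len′ k w P ext 1≤k w<k+len len≤len′ =
  trans (extend (len′ ∸ len)) (cong (λ l → countOutside P k l w) (m+[n∸m]≡n len≤len′))
  where
  extend : ∀ m → countOutside P k len w ≡ countOutside P k (len + m) w
  extend zero    = cong (λ l → countOutside P k l w) (sym (+-identityʳ len))
  extend (suc m) = trans (extend m)
    (trans (countOutside-len-suc (len + m) k w P ext 1≤k (<-≤-trans w<k+len (+-monoʳ-≤ k (m≤m+n len m))))
           (cong (λ l → countOutside P k l w) (sym (+-suc len m))))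

-- Membership in L_k^ℓ through the exponents it inspects

oddGens : ℕ → ℕ → ℕ → Bool
oddGens r x y = (2 ≤ᵇ x) ∨ ((1 ≤ᵇ x) ∧ ((r ∸ 1) ≤ᵇ y))

pairGens : ℕ → ℕ → ℕ → Bool
pairGens r x z = anyR (λ n → ((r ∸ n) ≤ᵇ x) ∧ (n ≤ᵇ z)) 0 (r ∸ 1)

tripleGens : ℕ → ℕ → ℕ → ℕ → Bool
tripleGens r x y z = anyR (λ n → ((r ∸ n ∸ 1) ≤ᵇ x) ∧ (1 ≤ᵇ y) ∧ (n ≤ᵇ z)) 0 (r ∸ 2)

genAtExps : ℕ → Bool → ℕ → ℕ → ℕ → Bool
genAtExps r odd x y z = if odd then oddGens r x y else pairGens r x z ∨ tripleGens r x y z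

-- x_k^{ℓ-t} x_{k+2}^{r-ℓ+t} and x_k^{ℓ-t} x_{k+1} x_{k+2}^{r-ℓ+t-1} (1 ≤ t ≤ ℓ-1)
familyA : ℕ → ℕ → ℕ → ℕ → Bool
familyA r ℓ x z = anyR (λ t → ((ℓ ∸ t) ≤ᵇ x) ∧ (((r ∸ ℓ) + t) ≤ᵇ z)) 1 (ℓ ∸ 1)

familyB : ℕ → ℕ → ℕ → ℕ → ℕ → Bool
familyB r ℓ x y z = anyR (λ t → ((ℓ ∸ t) ≤ᵇ x) ∧ (1 ≤ᵇ y) ∧ (((r ∸ ℓ) + t ∸ 1) ≤ᵇ z)) 1 (ℓ ∸ 1)

inLℓevenExps : ℕ → ℕ → ℕ → ℕ → ℕ → Bool → Bool
inLℓevenExps r ℓ x y z L = (ℓ ≤ᵇ x) ∨ familyA r ℓ x z ∨ familyB r ℓ x y z ∨ L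

inLℓoddExps : ℕ → ℕ → ℕ → Bool → Bool
inLℓoddExps ℓ x y M = (2 ≤ᵇ x) ∨ ((1 ≤ᵇ x) ∧ ((ℓ ∸ 1) ≤ᵇ y)) ∨ M

inHead : ℕ → ℕ → ℕ → Bool
inHead ℓ a b = inLℓoddExps ℓ a b (ℓ ≤ᵇ b)

m∸n∸1≡m∸[1+n] : ∀ m n → m ∸ n ∸ 1 ≡ m ∸ suc n
m∸n∸1≡m∸[1+n] m n = trans (∸-+-assoc m n 1) (cong (m ∸_) (+-comm n 1))

m∸n∸o≡m∸o∸n : ∀ m n o → m ∸ n ∸ o ≡ m ∸ o ∸ n
m∸n∸o≡m∸o∸n m n o = trans (∸-+-assoc m n o) (trans (cong (m ∸_) (+-comm n o)) (sym (∸-+-assoc m o n)))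

[m∸o]∸[n∸o]≡m∸n : ∀ m o n → o ≤ n → (m ∸ o) ∸ (n ∸ o) ≡ m ∸ n
[m∸o]∸[n∸o]≡m∸n m o n o≤n = trans (∸-+-assoc m o (n ∸ o)) (cong (m ∸_) (m+[n∸m]≡n o≤n))

[m∸n]+[n∸o]≡m∸o : ∀ m n o → o ≤ n → n ≤ m → (m ∸ n) + (n ∸ o) ≡ m ∸ o
[m∸n]+[n∸o]≡m∸o m n o o≤n n≤m = trans (sym (+-∸-assoc (m ∸ n) o≤n)) (cong (_∸ o) (m∸n+n≡m n≤m))

m∸o≤[m∸n]+t : ∀ m n o t → n ≤ m → n ∸ t ≤ o → m ∸ o ≤ (m ∸ n) + t
m∸o≤[m∸n]+t m n o t n≤m n∸t≤o = m≤n+o⇒m∸n≤o m o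
  (subst₂ _≤_ (m∸n+n≡m n≤m) (trans (sym (+-assoc (m ∸ n) t o)) (+-comm ((m ∸ n) + t) o))
          (+-monoʳ-≤ (m ∸ n) (≤-trans (m≤n+m∸n n t) (+-monoʳ-≤ t n∸t≤o))))

n∸o≤m∸o∸1 : ∀ m o n → n ≤ m ∸ 1 → n ∸ o ≤ m ∸ o ∸ 1
n∸o≤m∸o∸1 m o n n≤m∸1 = subst (n ∸ o ≤_) (m∸n∸o≡m∸o∸n m 1 o) (∸-monoˡ-≤ o n≤m∸1)

o+t≤m∸1 : ∀ m o t → t ≤ m ∸ o ∸ 1 → o ≤ m ∸ 1 → o + t ≤ m ∸ 1
o+t≤m∸1 m o t t≤ o≤ = subst (_≤ m ∸ 1) (+-comm t o) (m≤o∸n⇒m+n≤o t o≤ (subst (t ≤_) (m∸n∸o≡m∸o∸n m o 1) t≤))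

-- xᵢ is the exponent of x_{k+i} (k odd) and L is membership in L_{k+4}.  For x₁ < ℓ and
-- m in S_{k+2}, colon says x_{k+1}^{x₁} m ∈ L_{k+1}^ℓ iff m ∈ L_{k+2}^{r-x₁}.
module Colon (r′ ℓ x₁ x₂ x₃ x₄ x₅ : ℕ) (L : Bool) where
  r ℓ′ : ℕ
  r  = suc (suc r′)
  ℓ′ = r ∸ x₁

  inRest inTail : Bool
  inRest = inLℓevenExps r ℓ x₁ x₂ x₃ (oddGens r x₂ x₃ ∨ ((pairGens r x₃ x₅ ∨ tripleGens r x₃ x₄ x₅) ∨ L))
  inTail = inLℓoddExps ℓ′ x₂ x₃ (inLℓevenExps r ℓ′ x₃ x₄ x₅ L)

  module _ (x₁<ℓ : x₁ < ℓ) (ℓ≤r : ℓ ≤ r) where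
    private
      x₁≤ℓ : x₁ ≤ ℓ
      x₁≤ℓ = <⇒≤ x₁<ℓ
      x₁≤r : x₁ ≤ r
      x₁≤r = ≤-trans x₁≤ℓ ℓ≤r
      x₁≤r∸1 : x₁ ≤ r ∸ 1
      x₁≤r∸1 = s≤s⁻¹ (≤-trans x₁<ℓ ℓ≤r)
      r∸ℓ′≡x₁ : r ∸ ℓ′ ≡ x₁
      r∸ℓ′≡x₁ = m∸[m∸n]≡n x₁≤r

      A′ B′ L′ : Bool
      A′ = familyA r ℓ′ x₃ x₅
      B′ = familyB r ℓ′ x₃ x₄ x₅
      L′ = inLℓevenExps r ℓ′ x₃ x₄ x₅ L

      tail-L′ : L′ ≡ true → inTail ≡ true
      tail-L′ p = ∨-trueʳ (2 ≤ᵇ x₂) (∨-trueʳ ((1 ≤ᵇ x₂) ∧ ((ℓ′ ∸ 1) ≤ᵇ x₃)) p)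
      tail-x₂x₃ : (1 ≤ᵇ x₂) ≡ true → ((ℓ′ ∸ 1) ≤ᵇ x₃) ≡ true → inTail ≡ true
      tail-x₂x₃ p q = ∨-trueʳ (2 ≤ᵇ x₂) (∨-trueˡ L′ (∧-true⁺ p q))
      tail-x₃ : (ℓ′ ≤ᵇ x₃) ≡ true → inTail ≡ true
      tail-x₃ p = tail-L′ (∨-trueˡ (A′ ∨ B′ ∨ L) p)
      tail-A′ : A′ ≡ true → inTail ≡ true
      tail-A′ p = tail-L′ (∨-trueʳ (ℓ′ ≤ᵇ x₃) (∨-trueˡ (B′ ∨ L) p))
      tail-B′ : B′ ≡ true → inTail ≡ true
      tail-B′ p = tail-L′ (∨-trueʳ (ℓ′ ≤ᵇ x₃) (∨-trueʳ A′ (∨-trueˡ L p)))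
      tail-L : L ≡ true → inTail ≡ true
      tail-L p = tail-L′ (∨-trueʳ (ℓ′ ≤ᵇ x₃) (∨-trueʳ A′ (∨-trueʳ B′ p)))

      familyA⇒tail : familyA r ℓ x₁ x₃ ≡ true → inTail ≡ true
      familyA⇒tail p with anyR⁻ {_} {1} {ℓ ∸ 1} p
      ... | t , _ , _ , q with ∧-true⁻ q
      ...   | q₁ , q₂ = tail-x₃ (≤⇒≤ᵇ≡true (≤-trans (m∸o≤[m∸n]+t r ℓ x₁ t ℓ≤r (≤ᵇ≡true⇒≤ q₁)) (≤ᵇ≡true⇒≤ q₂)))

      familyB⇒tail : familyB r ℓ x₁ x₂ x₃ ≡ true → inTail ≡ true
      familyB⇒tail p with anyR⁻ {_} {1} {ℓ ∸ 1} p
      ... | t , _ , _ , q with ∧-true⁻ q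
      ...   | q₁ , q₂₃ with ∧-true⁻ q₂₃
      ...     | q₂ , q₃ = tail-x₂x₃ q₂
        (≤⇒≤ᵇ≡true (≤-trans (∸-monoˡ-≤ 1 (m∸o≤[m∸n]+t r ℓ x₁ t ℓ≤r (≤ᵇ≡true⇒≤ q₁))) (≤ᵇ≡true⇒≤ q₃)))

      oddGens⇒tail : oddGens r x₂ x₃ ≡ true → inTail ≡ true
      oddGens⇒tail p with ∨-true⁻ p
      ... | inj₁ q = ∨-trueˡ (((1 ≤ᵇ x₂) ∧ ((ℓ′ ∸ 1) ≤ᵇ x₃)) ∨ L′) q
      ... | inj₂ q with ∧-true⁻ q
      ...   | q₁ , q₂ = tail-x₂x₃ q₁ (≤⇒≤ᵇ≡true (≤-trans (∸-monoˡ-≤ 1 (m∸n≤m r x₁)) (≤ᵇ≡true⇒≤ q₂)))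

      pairGens⇒tail : pairGens r x₃ x₅ ≡ true → inTail ≡ true
      pairGens⇒tail p with anyR⁻ {_} {0} {r ∸ 1} p
      ... | n , _ , n≤ , q with ∧-true⁻ q | n ≤? x₁
      ...   | q₁ , q₂ | yes n≤x₁ = tail-x₃ (≤⇒≤ᵇ≡true (≤-trans (∸-monoʳ-≤ r n≤x₁) (≤ᵇ≡true⇒≤ q₁)))
      ...   | q₁ , q₂ | no n≰x₁ = tail-A′ (anyR⁺ {_} {1} {ℓ′ ∸ 1} (n ∸ x₁) (m<n⇒0<n∸m x₁<n) (n∸o≤m∸o∸1 r x₁ n n≤)
                                    (∧-true⁺ (≤⇒≤ᵇ≡true e₃) (≤⇒≤ᵇ≡true e₅)))
        where
        x₁<n = ≰⇒> n≰x₁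
        e₃ : ℓ′ ∸ (n ∸ x₁) ≤ x₃
        e₃ = subst (_≤ x₃) (sym ([m∸o]∸[n∸o]≡m∸n r x₁ n (<⇒≤ x₁<n))) (≤ᵇ≡true⇒≤ q₁)
        e₅ : (r ∸ ℓ′) + (n ∸ x₁) ≤ x₅
        e₅ = subst (_≤ x₅) (sym (trans (cong (_+ (n ∸ x₁)) r∸ℓ′≡x₁) (m+[n∸m]≡n (<⇒≤ x₁<n)))) (≤ᵇ≡true⇒≤ q₂)

      tripleGens⇒tail : tripleGens r x₃ x₄ x₅ ≡ true → inTail ≡ true
      tripleGens⇒tail p with anyR⁻ {_} {0} {r ∸ 2} p
      ... | n , _ , n≤ , q with ∧-true⁻ q | suc n ≤? x₁
      ...   | q₁ , q₂₃ | yes sn≤x₁ =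
        tail-x₃ (≤⇒≤ᵇ≡true (≤-trans (∸-monoʳ-≤ r sn≤x₁) (subst (_≤ x₃) (m∸n∸1≡m∸[1+n] r n) (≤ᵇ≡true⇒≤ q₁))))
      ...   | q₁ , q₂₃ | no sn≰x₁ = tail-B′ (anyR⁺ {_} {1} {ℓ′ ∸ 1} (suc n ∸ x₁) (m<n⇒0<n∸m x₁<sn)
                                       (n∸o≤m∸o∸1 r x₁ (suc n) (s≤s n≤))
                                       (∧-true⁺ (≤⇒≤ᵇ≡true e₃) (∧-true⁺ (proj₁ (∧-true⁻ q₂₃)) (≤⇒≤ᵇ≡true e₅))))
        where
        x₁<sn = ≰⇒> sn≰x₁
        e₃ : ℓ′ ∸ (suc n ∸ x₁) ≤ x₃
        e₃ = subst (_≤ x₃) (trans (m∸n∸1≡m∸[1+n] r n) (sym ([m∸o]∸[n∸o]≡m∸n r x₁ (suc n) (<⇒≤ x₁<sn)))) (≤ᵇ≡true⇒≤ q₁)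
        e₅ : (r ∸ ℓ′) + (suc n ∸ x₁) ∸ 1 ≤ x₅
        e₅ = subst (_≤ x₅) (sym (cong (_∸ 1) (trans (cong (_+ (suc n ∸ x₁)) r∸ℓ′≡x₁) (m+[n∸m]≡n (<⇒≤ x₁<sn)))))
                   (≤ᵇ≡true⇒≤ (proj₂ (∧-true⁻ q₂₃)))

    inRest⇒inTail : inRest ≡ true → inTail ≡ true
    inRest⇒inTail h with ∨-true⁻ h
    ... | inj₁ ℓ≤x₁ = contradiction (≤ᵇ≡true⇒≤ ℓ≤x₁) (<⇒≱ x₁<ℓ)
    ... | inj₂ h with ∨-true⁻ h
    ...   | inj₁ a = familyA⇒tail a
    ...   | inj₂ h with ∨-true⁻ h
    ...     | inj₁ b = familyB⇒tail b
    ...     | inj₂ h with ∨-true⁻ h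
    ...       | inj₁ o = oddGens⇒tail o
    ...       | inj₂ h with ∨-true⁻ h
    ...         | inj₂ l = tail-L l
    ...         | inj₁ g with ∨-true⁻ g
    ...           | inj₁ pg = pairGens⇒tail pg
    ...           | inj₂ tg = tripleGens⇒tail tg

    private
      famA famB odd₂ pair₃ triple₃ : Bool
      famA    = familyA r ℓ x₁ x₃
      famB    = familyB r ℓ x₁ x₂ x₃
      odd₂    = oddGens r x₂ x₃
      pair₃   = pairGens r x₃ x₅
      triple₃ = tripleGens r x₃ x₄ x₅

      rest-A : famA ≡ true → inRest ≡ true
      rest-A p = ∨-trueʳ (ℓ ≤ᵇ x₁) (∨-trueˡ (famB ∨ odd₂ ∨ (pair₃ ∨ triple₃) ∨ L) p)
      rest-B : famB ≡ true → inRest ≡ true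
      rest-B p = ∨-trueʳ (ℓ ≤ᵇ x₁) (∨-trueʳ famA (∨-trueˡ (odd₂ ∨ (pair₃ ∨ triple₃) ∨ L) p))
      rest-L₂ : odd₂ ∨ (pair₃ ∨ triple₃) ∨ L ≡ true → inRest ≡ true
      rest-L₂ p = ∨-trueʳ (ℓ ≤ᵇ x₁) (∨-trueʳ famA (∨-trueʳ famB p))
      rest-odd : odd₂ ≡ true → inRest ≡ true
      rest-odd p = rest-L₂ (∨-trueˡ ((pair₃ ∨ triple₃) ∨ L) p)
      rest-pair : pair₃ ≡ true → inRest ≡ true
      rest-pair p = rest-L₂ (∨-trueʳ odd₂ (∨-trueˡ L (∨-trueˡ triple₃ p)))
      rest-triple : triple₃ ≡ true → inRest ≡ true
      rest-triple p = rest-L₂ (∨-trueʳ odd₂ (∨-trueˡ L (∨-trueʳ pair₃ p)))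
      rest-L : L ≡ true → inRest ≡ true
      rest-L p = rest-L₂ (∨-trueʳ odd₂ (∨-trueʳ (pair₃ ∨ triple₃) p))

      ℓ∸[ℓ∸x₁]≤x₁ : ℓ ∸ (ℓ ∸ x₁) ≤ x₁
      ℓ∸[ℓ∸x₁]≤x₁ = ≤-reflexive (m∸[m∸n]≡n x₁≤ℓ)

      x₂x₃⇒rest : (1 ≤ᵇ x₂) ≡ true → ((ℓ′ ∸ 1) ≤ᵇ x₃) ≡ true → inRest ≡ true
      x₂x₃⇒rest p q with 1 ≤? x₁
      ... | no x₁≱1 = rest-odd (∨-trueʳ (2 ≤ᵇ x₂)
            (∧-true⁺ p (subst (λ z → ((r ∸ z) ∸ 1 ≤ᵇ x₃) ≡ true) (n<1⇒n≡0 (≰⇒> x₁≱1)) q)))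
      ... | yes 1≤x₁ = rest-B (anyR⁺ {_} {1} {ℓ ∸ 1} (ℓ ∸ x₁) (m<n⇒0<n∸m x₁<ℓ) (∸-monoʳ-≤ ℓ 1≤x₁)
              (∧-true⁺ (≤⇒≤ᵇ≡true ℓ∸[ℓ∸x₁]≤x₁) (∧-true⁺ p (≤⇒≤ᵇ≡true
                (subst (λ z → z ∸ 1 ≤ x₃) (sym ([m∸n]+[n∸o]≡m∸o r ℓ x₁ x₁≤ℓ ℓ≤r)) (≤ᵇ≡true⇒≤ q))))))

      x₃⇒rest : (ℓ′ ≤ᵇ x₃) ≡ true → inRest ≡ true
      x₃⇒rest p with 1 ≤? x₁
      ... | no x₁≱1 = rest-pair (anyR⁺ {λ n → ((r ∸ n) ≤ᵇ x₃) ∧ (n ≤ᵇ x₅)} {0} {r ∸ 1} 0 z≤n z≤n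
              (∧-true⁺ (subst (λ z → ((r ∸ z) ≤ᵇ x₃) ≡ true) (n<1⇒n≡0 (≰⇒> x₁≱1)) p) refl))
      ... | yes 1≤x₁ = rest-A (anyR⁺ {_} {1} {ℓ ∸ 1} (ℓ ∸ x₁) (m<n⇒0<n∸m x₁<ℓ) (∸-monoʳ-≤ ℓ 1≤x₁)
              (∧-true⁺ (≤⇒≤ᵇ≡true ℓ∸[ℓ∸x₁]≤x₁)
                       (≤⇒≤ᵇ≡true (subst (_≤ x₃) (sym ([m∸n]+[n∸o]≡m∸o r ℓ x₁ x₁≤ℓ ℓ≤r)) (≤ᵇ≡true⇒≤ p)))))

      familyA′⇒rest : A′ ≡ true → inRest ≡ true
      familyA′⇒rest p with anyR⁻ {_} {1} {ℓ′ ∸ 1} p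
      ... | t , _ , t≤ , q with ∧-true⁻ q
      ...   | q₃ , q₅ = rest-pair (anyR⁺ {λ n → ((r ∸ n) ≤ᵇ x₃) ∧ (n ≤ᵇ x₅)} {0} {r ∸ 1} (x₁ + t) z≤n
                                   (o+t≤m∸1 r x₁ t t≤ x₁≤r∸1)
              (∧-true⁺ (≤⇒≤ᵇ≡true (subst (_≤ x₃) (∸-+-assoc r x₁ t) (≤ᵇ≡true⇒≤ q₃)))
                       (≤⇒≤ᵇ≡true (subst (_≤ x₅) (cong (_+ t) r∸ℓ′≡x₁) (≤ᵇ≡true⇒≤ q₅)))))

      familyB′⇒rest : B′ ≡ true → inRest ≡ true
      familyB′⇒rest p with anyR⁻ {_} {1} {ℓ′ ∸ 1} p
      ... | suc t , _ , t≤ , q with ∧-true⁻ q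
      ...   | q₃ , q₄₅ with ∧-true⁻ q₄₅
      ...     | q₄ , q₅ = rest-triple (anyR⁺ {_} {0} {r ∸ 2} (x₁ + t) z≤n x₁+t≤r′
                                       (∧-true⁺ (≤⇒≤ᵇ≡true e₃) (∧-true⁺ q₄ (≤⇒≤ᵇ≡true e₅))))
        where
        x₁+t≤r′ : x₁ + t ≤ r′
        x₁+t≤r′ = s≤s⁻¹ (subst (_≤ suc r′) (+-suc x₁ t) (o+t≤m∸1 r x₁ (suc t) t≤ x₁≤r∸1))
        e₃ : r ∸ (x₁ + t) ∸ 1 ≤ x₃
        e₃ = subst (_≤ x₃) (sym (trans (m∸n∸1≡m∸[1+n] r (x₁ + t))
                                       (trans (cong (r ∸_) (sym (+-suc x₁ t))) (sym (∸-+-assoc r x₁ (suc t))))))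
                   (≤ᵇ≡true⇒≤ q₃)
        e₅ : x₁ + t ≤ x₅
        e₅ = subst (_≤ x₅) (trans (cong (λ z → z + suc t ∸ 1) r∸ℓ′≡x₁) (cong (_∸ 1) (+-suc x₁ t))) (≤ᵇ≡true⇒≤ q₅)

    inTail⇒inRest : inTail ≡ true → inRest ≡ true
    inTail⇒inRest h with ∨-true⁻ h
    ... | inj₁ p = rest-odd (∨-trueˡ ((1 ≤ᵇ x₂) ∧ ((r ∸ 1) ≤ᵇ x₃)) p)
    ... | inj₂ h with ∨-true⁻ h
    ...   | inj₁ p = let (q₂ , q₃) = ∧-true⁻ p in x₂x₃⇒rest q₂ q₃
    ...   | inj₂ h with ∨-true⁻ h
    ...     | inj₁ p = x₃⇒rest p
    ...     | inj₂ h with ∨-true⁻ h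
    ...       | inj₁ p = familyA′⇒rest p
    ...       | inj₂ h with ∨-true⁻ h
    ...         | inj₁ p = familyB′⇒rest p
    ...         | inj₂ p = rest-L p

    colon : inRest ≡ inTail
    colon = true-iff⇒≡ inRest⇒inTail inTail⇒inRest

inLℓoddExps-split : ∀ ℓ a b M N → (b < ℓ → (ℓ ≤ᵇ b) ∨ M ≡ N) →
                    inLℓoddExps ℓ a b ((ℓ ≤ᵇ b) ∨ M) ≡ inHead ℓ a b ∨ N
inLℓoddExps-split ℓ a b M N colon with ℓ ≤? b
... | yes ℓ≤b rewrite ≤⇒≤ᵇ≡true ℓ≤b | ∨-zeroʳ ((1 ≤ᵇ a) ∧ ((ℓ ∸ 1) ≤ᵇ b)) | ∨-zeroʳ (2 ≤ᵇ a) = refl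
... | no ℓ≰b = begin
  (2 ≤ᵇ a) ∨ (X ∨ ((ℓ ≤ᵇ b) ∨ M)) ≡⟨ cong (λ z → (2 ≤ᵇ a) ∨ (X ∨ z)) (colon b<ℓ) ⟩
  (2 ≤ᵇ a) ∨ (X ∨ N)                ≡⟨ sym (∨-assoc (2 ≤ᵇ a) X N) ⟩
  ((2 ≤ᵇ a) ∨ X) ∨ N                ≡⟨ cong (λ z → ((2 ≤ᵇ a) ∨ z) ∨ N)
                                            (sym (trans (cong (X ∨_) (>⇒≤ᵇ≡false b<ℓ)) (∨-identityʳ X))) ⟩
  inHead ℓ a b ∨ N                  ∎
  where
  b<ℓ = ≰⇒> ℓ≰b
  X = (1 ≤ᵇ a) ∧ ((ℓ ∸ 1) ≤ᵇ b)

isOdd-2+ : ∀ k → isOdd (suc (suc k)) ≡ isOdd k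
isOdd-2+ k = trans (cong (λ z → (z % 2) ≡ᵇ 1) (+-comm 2 k)) (cong (_≡ᵇ 1) ([m+kn]%n≡m%n k 1 2))

isOdd-suc : ∀ k → isOdd (suc k) ≡ not (isOdd k)
isOdd-suc zero    = refl
isOdd-suc (suc k) = trans (isOdd-2+ k) (sym (trans (cong not (isOdd-suc k)) (not-involutive (isOdd k))))

isOdd-2*J+1 : ∀ J → isOdd (2 * J + 1) ≡ true
isOdd-2*J+1 zero    = refl
isOdd-2*J+1 (suc J) = trans (cong (λ z → isOdd (z + 1)) (*-suc 2 J)) (trans (isOdd-2+ (2 * J + 1)) (isOdd-2*J+1 J))

inL-local : ∀ r k B {e e′ : Exp} → (∀ i → k ≤ i → e i ≡ e′ i) → inL r k B e ≡ inL r k B e′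
inL-local r k B {e} {e′} h = anyR-cong {genAt r e} {genAt r e′} {k} {B} (λ n k≤n →
  cong₃ (genAtExps r (isOdd n)) (h n k≤n) (h (suc n) (m≤n⇒m≤1+n k≤n)) (h (n + 2) (≤-trans k≤n (m≤m+n n 2))))

inLℓ-cong : ∀ r ℓ k B B′ {e e′ : Exp} → (∀ i → k ≤ i → e i ≡ e′ i) →
            (∀ k′ → k ≤ k′ → inL r k′ B e ≡ inL r k′ B′ e′) → inLℓ r ℓ k B e ≡ inLℓ r ℓ k B′ e′
inLℓ-cong r ℓ k B B′ {e} {e′} he hL = atParity (isOdd k)
  where
  evenAt : ∀ k₀ → k ≤ k₀ → inLℓeven r ℓ k₀ B e ≡ inLℓeven r ℓ k₀ B′ e′
  evenAt k₀ k≤k₀ rewrite he k₀ k≤k₀ | he (suc k₀) (m≤n⇒m≤1+n k≤k₀) | he (k₀ + 2) (≤-trans k≤k₀ (m≤m+n k₀ 2))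
                       | hL (suc k₀) (m≤n⇒m≤1+n k≤k₀) = refl
  byParity : Exp → ℕ → Bool → Bool
  byParity f Bd odd = if odd then inLℓoddExps ℓ (f k) (f (suc k)) (inLℓeven r ℓ (suc k) Bd f)
                      else inLℓeven r ℓ k Bd f
  atParity : ∀ odd → byParity e B odd ≡ byParity e′ B′ odd
  atParity true  = cong₃ (inLℓoddExps ℓ) (he k ≤-refl) (he (suc k) (n≤1+n k)) (evenAt (suc k) (n≤1+n k))
  atParity false = evenAt k ≤-refl

inLℓ-local : ∀ r ℓ k B {e e′ : Exp} → (∀ i → k ≤ i → e i ≡ e′ i) → inLℓ r ℓ k B e ≡ inLℓ r ℓ k B e′
inLℓ-local r ℓ k B h = inLℓ-cong r ℓ k B B h (λ k′ k≤k′ → inL-local r k′ B (λ i k′≤i → h i (≤-trans k≤k′ k′≤i)))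

-- Needs r ≥ 2: for r = 1 the truncated range 0 … r ∸ 2 of tripleGens still contains 0.
genAt-zero : ∀ r′ e n → e n ≡ 0 → genAt (suc (suc r′)) e n ≡ false
genAt-zero r′ e n en≡0 =
  trans (cong (λ x → genAtExps r (isOdd n) x (e (suc n)) (e (n + 2))) en≡0) (atParity (isOdd n))
  where
  r = suc (suc r′)
  atParity : ∀ odd → genAtExps r odd 0 (e (suc n)) (e (n + 2)) ≡ false
  atParity true  = refl
  atParity false = cong₂ _∨_
    (anyR-false {λ m → ((r ∸ m) ≤ᵇ 0) ∧ (m ≤ᵇ e (n + 2))} {0} {r ∸ 1}
      (λ m _ m≤ → cong (_∧ (m ≤ᵇ e (n + 2))) (>⇒≤ᵇ≡false (m<n⇒0<n∸m (s≤s m≤)))))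
    (anyR-false {λ m → ((r ∸ m ∸ 1) ≤ᵇ 0) ∧ (1 ≤ᵇ e (suc n)) ∧ (m ≤ᵇ e (n + 2))} {0} {r ∸ 2}
      (λ m _ m≤ → cong (_∧ ((1 ≤ᵇ e (suc n)) ∧ (m ≤ᵇ e (n + 2))))
                       (>⇒≤ᵇ≡false (subst (0 <_) (sym (m∸n∸1≡m∸[1+n] r m)) (m<n⇒0<n∸m (s≤s (s≤s m≤)))))))

inL-bound-mono : ∀ r′ k B B′ M e → (∀ i → M ≤ i → e i ≡ 0) → M ≤ B′ →
                 inL (suc (suc r′)) k B e ≡ true → inL (suc (suc r′)) k B′ e ≡ true
inL-bound-mono r′ k B B′ M e vanish M≤B′ h with anyR⁻ {genAt (suc (suc r′)) e} {k} {B} h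
... | n , k≤n , n≤B , q with M ≤? n
...   | yes M≤n = contradiction (trans (sym q) (genAt-zero r′ e n (vanish n M≤n))) λ ()
...   | no M≰n  = anyR⁺ {genAt (suc (suc r′)) e} {k} {B′} n k≤n (≤-trans (<⇒≤ (≰⇒> M≰n)) M≤B′) q

inLℓ-bound : ∀ r′ ℓ k B B′ M e → (∀ i → M ≤ i → e i ≡ 0) → M ≤ B → M ≤ B′ →
             inLℓ (suc (suc r′)) ℓ k B e ≡ inLℓ (suc (suc r′)) ℓ k B′ e
inLℓ-bound r′ ℓ k B B′ M e vanish M≤B M≤B′ = inLℓ-cong (suc (suc r′)) ℓ k B B′ {e} {e} (λ _ _ → refl)
  (λ k′ _ → true-iff⇒≡ (inL-bound-mono r′ k′ B B′ M e vanish M≤B′) (inL-bound-mono r′ k′ B′ B M e vanish M≤B))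

inLℓ-odd-split : ∀ r′ ℓ k B e → isOdd k ≡ true → ℓ ≤ suc (suc r′) → 3 + k ≤ B →
  inLℓ (suc (suc r′)) ℓ k B e
  ≡ inHead ℓ (e k) (e (suc k)) ∨ inLℓ (suc (suc r′)) (suc (suc r′) ∸ e (suc k)) (suc (suc k)) B e
inLℓ-odd-split r′ ℓ k B e k-odd ℓ≤r 3+k≤B = begin
  inLℓ r ℓ k B e
    ≡⟨ cong (λ odd → if odd then inLℓoddExps ℓ x₀ x₁ (inLℓeven r ℓ (suc k) B e) else inLℓeven r ℓ k B e) k-odd ⟩
  inLℓoddExps ℓ x₀ x₁ (inLℓevenExps r ℓ x₁ x₂ (e (suc k + 2)) (inL r k₂ B e))
    ≡⟨ cong₂ (λ x L → inLℓoddExps ℓ x₀ x₁ (inLℓevenExps r ℓ x₁ x₂ x L))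
             (cong (λ z → e (suc z)) (+-comm k 2)) unfold-inL ⟩
  inLℓoddExps ℓ x₀ x₁ (Colon.inRest r′ ℓ x₁ x₂ x₃ x₄ x₅ Lrest)
    ≡⟨ inLℓoddExps-split ℓ x₀ x₁ _ _ (λ x₁<ℓ → Colon.colon r′ ℓ x₁ x₂ x₃ x₄ x₅ Lrest x₁<ℓ ℓ≤r) ⟩
  inHead ℓ x₀ x₁ ∨ Colon.inTail r′ ℓ x₁ x₂ x₃ x₄ x₅ Lrest
    ≡⟨ cong (λ odd → inHead ℓ x₀ x₁ ∨ (if odd then Colon.inTail r′ ℓ x₁ x₂ x₃ x₄ x₅ Lrest
                                       else inLℓeven r (r ∸ x₁) k₂ B e)) (sym k₂-odd) ⟩
  inHead ℓ x₀ x₁ ∨ inLℓ r (r ∸ x₁) k₂ B e ∎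
  where
  r  = suc (suc r′)
  k₂ = suc (suc k)
  x₀ = e k
  x₁ = e (suc k)
  x₂ = e k₂
  x₃ = e (suc k₂)
  x₄ = e (suc (suc k₂))
  x₅ = e (suc k₂ + 2)
  Lrest = inL r (suc (suc k₂)) B e
  k₂-odd : isOdd k₂ ≡ true
  k₂-odd = trans (isOdd-2+ k) k-odd
  unfold-inL : inL r k₂ B e ≡ oddGens r x₂ x₃ ∨ ((pairGens r x₃ x₅ ∨ tripleGens r x₃ x₄ x₅) ∨ Lrest)
  unfold-inL = trans (anyR-unfold (genAt r e) k₂ B (≤-trans (n≤1+n k₂) 3+k≤B))
    (cong₂ _∨_ (cong (λ odd → genAtExps r odd x₂ x₃ (e (k₂ + 2))) k₂-odd)
      (trans (anyR-unfold (genAt r e) (suc k₂) B 3+k≤B)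
             (cong (_∨ Lrest) (cong (λ odd → genAtExps r odd x₃ x₄ x₅) (trans (isOdd-suc k₂) (cong not k₂-odd))))))

HP≡countOutside : ∀ r′ ℓ k B w → k + w ≤ B →
                  HP (suc (suc r′)) k ℓ w ≡ countOutside (inLℓ (suc (suc r′)) ℓ k B) k w w
HP≡countOutside r′ ℓ k B w k+w≤B =
  trans (length-filter-false _ (mons k w w))
        (countFalse-congᴬ (mons k w w) (All.map (λ {xs} → bound-irrelevant {xs}) (mons-length k w w)))
  where
  bound-irrelevant : ∀ {xs} → length xs ≡ w →
    inLℓ (suc (suc r′)) ℓ k (k + w + 2) (toExp k xs) ≡ inLℓ (suc (suc r′)) ℓ k B (toExp k xs)
  bound-irrelevant {xs} len≡w = inLℓ-bound r′ ℓ k (k + w + 2) B (k + w) (toExp k xs)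
    (λ i k+w≤i → toExp-beyond k xs i (subst (λ z → k + z ≤ i) (sym len≡w) k+w≤i)) (m≤m+n (k + w) 2) k+w≤B

module OddExpansion (r′ k ℓ′ w : ℕ) (k-odd : isOdd k ≡ true) (1≤k : 1 ≤ k) (ℓ≤r : suc ℓ′ ≤ suc (suc r′)) where
  private
    r ℓ k₂ B : ℕ
    r  = suc (suc r′)
    ℓ  = suc ℓ′
    k₂ = suc (suc k)
    B  = 3 + k + w

    P : Exp → Bool
    P = inLℓ r ℓ k B
    Q : ℕ → Exp → Bool
    Q β = inLℓ r (r ∸ β) k₂ B
    H : ℕ → Series
    H β = HP r k₂ (r ∸ β)

    P-ext : Extensional P
    P-ext e≗e′ = inLℓ-local r ℓ k B (λ i _ → e≗e′ i)

    P-split : ∀ α β e → ((P ⟨ k ≔ α ⟩) ⟨ suc k ≔ β ⟩) e ≡ inHead ℓ α β ∨ Q β e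
    P-split α β e = trans (inLℓ-odd-split r′ ℓ k B e* k-odd ℓ≤r (m≤m+n (3 + k) w))
      (trans (cong₂ (λ x y → inHead ℓ x y ∨ inLℓ r (r ∸ y) k₂ B e*) e*-k e*-sk)
             (cong (inHead ℓ α β ∨_) (inLℓ-local r (r ∸ β) k₂ B e*≡e)))
      where
      e* = setExp k α (setExp (suc k) β e)
      e*-k : e* k ≡ α
      e*-k = setExp-same k α (setExp (suc k) β e)
      e*-sk : e* (suc k) ≡ β
      e*-sk = trans (setExp-other k α (setExp (suc k) β e) 1+n≢n) (setExp-same (suc k) β e)
      e*≡e : ∀ i → k₂ ≤ i → e* i ≡ e i
      e*≡e i k₂≤i = trans (setExp-other k α (setExp (suc k) β e) (>⇒≢ (≤-trans (n≤1+n (suc k)) k₂≤i)))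
                          (setExp-other (suc k) β e (>⇒≢ k₂≤i))

    Q-count : ∀ β w′ → w′ ≤ w → countOutside (Q β) k₂ w w′ ≡ H β w′
    Q-count β w′ w′≤w = begin
      countOutside (Q β) k₂ w w′
        ≡⟨ sym (countOutside-len w′ w k₂ w′ (Q β) (λ e≗e′ → inLℓ-local r (r ∸ β) k₂ B (λ i _ → e≗e′ i))
                  (s≤s z≤n) (s≤s (m≤n+m w′ (suc k))) w′≤w) ⟩
      countOutside (Q β) k₂ w′ w′
        ≡⟨ sym (HP≡countOutside r′ (r ∸ β) k₂ B w′ (s≤s (+-mono-≤ (n≤1+n (suc k)) w′≤w))) ⟩
      H β w′ ∎

    -- Standard monomials of weight w with exponent α on x_k (row) and β on x_{k+1} (term).
    term : ℕ → ℕ → ℕ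
    term α β = if suc k * β ≤ᵇ w ∸ k * α then (if inHead ℓ α β then 0 else H β (w ∸ k * α ∸ suc k * β)) else 0

    row : ℕ → ℕ
    row α = if k * α ≤ᵇ w then sumTo (term α) (suc (w ∸ k * α)) else 0

    HP≡sum-rows : HP r k ℓ w ≡ sumTo row (suc w)
    HP≡sum-rows = begin
      HP r k ℓ w
        ≡⟨ HP≡countOutside r′ ℓ k B w (+-monoˡ-≤ w (m≤n+m k 3)) ⟩
      countOutside P k w w
        ≡⟨ countOutside-len w (suc (suc w)) k w P P-ext 1≤k (+-monoˡ-≤ w 1≤k) (m≤n⇒m≤1+n (n≤1+n w)) ⟩
      countOutside P k (suc (suc w)) w
        ≡⟨ countOutside-suc P k (suc w) w P-ext ⟩
      sumTo (λ α → if k * α ≤ᵇ w then countOutside (P ⟨ k ≔ α ⟩) (suc k) (suc w) (w ∸ k * α) else 0) (suc w)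
        ≡⟨ sumTo-cong (suc w) (λ α _ → cong (λ z → if k * α ≤ᵇ w then z else 0) (row≡ α)) ⟩
      sumTo row (suc w) ∎
      where
      cell : ∀ α β → countOutside ((P ⟨ k ≔ α ⟩) ⟨ suc k ≔ β ⟩) k₂ w (w ∸ k * α ∸ suc k * β)
                     ≡ (if inHead ℓ α β then 0 else H β (w ∸ k * α ∸ suc k * β))
      cell α β = trans (countFalse-cong (mons k₂ w w′) (λ ys → P-split α β (toExp k₂ ys)))
                 (trans (countFalse-∨ (inHead ℓ α β) (λ ys → Q β (toExp k₂ ys)) (mons k₂ w w′))
                        (cong (λ z → if inHead ℓ α β then 0 else z)
                              (Q-count β w′ (≤-trans (m∸n≤m (w ∸ k * α) (suc k * β)) (m∸n≤m w (k * α))))))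
        where w′ = w ∸ k * α ∸ suc k * β
      row≡ : ∀ α → countOutside (P ⟨ k ≔ α ⟩) (suc k) (suc w) (w ∸ k * α) ≡ sumTo (term α) (suc (w ∸ k * α))
      row≡ α = trans (countOutside-suc (P ⟨ k ≔ α ⟩) (suc k) w (w ∸ k * α) (⟨≔⟩-extensional P k α P-ext))
                     (sumTo-cong (suc (w ∸ k * α))
                        (λ β _ → cong (λ z → if suc k * β ≤ᵇ w ∸ k * α then z else 0) (cell α β)))

    term-head : ∀ α β → inHead ℓ α β ≡ true → term α β ≡ 0
    term-head α β p rewrite p = if-eta (suc k * β ≤ᵇ w ∸ k * α)

    term-heavy : ∀ α β → w ∸ k * α < β → term α β ≡ 0
    term-heavy α β p rewrite >⇒≤ᵇ≡false {suc k * β} {w ∸ k * α} (<-≤-trans p (m≤n*m β (suc k))) = refl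

    term-open : ∀ α β → inHead ℓ α β ≡ false → k * α ≤ w → term α β ≡ shift (k * α + suc k * β) (H β) w
    term-open α β p kα≤w rewrite p = shift-+ (k * α) (suc k * β) (H β) w kα≤w

    row-light : ∀ α → k * α ≤ w → row α ≡ sumTo (term α) (suc (w ∸ k * α))
    row-light α kα≤w rewrite ≤⇒≤ᵇ≡true kα≤w = refl

    row-heavy : ∀ α → suc w ≤ α → row α ≡ 0
    row-heavy α p rewrite >⇒≤ᵇ≡false {k * α} {w} (<-≤-trans p (m≤n*m α k {{>-nonZero 1≤k}})) = refl

    row-≥2 : ∀ α → 2 ≤ α → row α ≡ 0
    row-≥2 α 2≤α = trans (cong (λ z → if k * α ≤ᵇ w then z else 0)
                          (sumTo-≡0 (suc (w ∸ k * α)) (λ β _ → term-head α β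
                             (∨-trueˡ (((1 ≤ᵇ α) ∧ ((ℓ ∸ 1) ≤ᵇ β)) ∨ (ℓ ≤ᵇ β)) (≤⇒≤ᵇ≡true 2≤α)))))
                         (if-eta (k * α ≤ᵇ w))

    row-0 : row 0 ≡ sumTo (λ β → shift (suc k * β) (H β) w) ℓ
    row-0 = begin
      row 0                             ≡⟨ row-light 0 k*0≤w ⟩
      sumTo (term 0) (suc (w ∸ k * 0))  ≡⟨ sumTo-cutoff _ ℓ (term-heavy 0) (λ β ℓ≤β → term-head 0 β (≤⇒≤ᵇ≡true ℓ≤β)) ⟩
      sumTo (term 0) ℓ                  ≡⟨ sumTo-cong ℓ term-0 ⟩
      sumTo (λ β → shift (suc k * β) (H β) w) ℓ ∎
      where
      k*0≤w : k * 0 ≤ w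
      k*0≤w = subst (_≤ w) (sym (*-zeroʳ k)) z≤n
      term-0 : ∀ β → β < ℓ → term 0 β ≡ shift (suc k * β) (H β) w
      term-0 β β<ℓ = trans (term-open 0 β (>⇒≤ᵇ≡false β<ℓ) k*0≤w)
                           (cong (λ a → shift (a + suc k * β) (H β) w) (*-zeroʳ k))

    row-1 : row 1 ≡ sumTo (λ β → shift (k + suc k * β) (H β) w) ℓ′
    row-1 with k ≤? w
    ... | yes k≤w = begin
      row 1                             ≡⟨ row-light 1 k*1≤w ⟩
      sumTo (term 1) (suc (w ∸ k * 1))  ≡⟨ sumTo-cutoff _ ℓ′ (term-heavy 1)
                                             (λ β ℓ′≤β → term-head 1 β (∨-trueˡ (ℓ ≤ᵇ β) (≤⇒≤ᵇ≡true ℓ′≤β))) ⟩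
      sumTo (term 1) ℓ′                 ≡⟨ sumTo-cong ℓ′ term-1 ⟩
      sumTo (λ β → shift (k + suc k * β) (H β) w) ℓ′ ∎
      where
      k*1≤w : k * 1 ≤ w
      k*1≤w = subst (_≤ w) (sym (*-identityʳ k)) k≤w
      term-1 : ∀ β → β < ℓ′ → term 1 β ≡ shift (k + suc k * β) (H β) w
      term-1 β β<ℓ′ = trans (term-open 1 β (cong₂ _∨_ (>⇒≤ᵇ≡false β<ℓ′) (>⇒≤ᵇ≡false (m≤n⇒m≤1+n β<ℓ′))) k*1≤w)
                            (cong (λ a → shift (a + suc k * β) (H β) w) (*-identityʳ k))
    ... | no k≰w rewrite >⇒≤ᵇ≡false {k * 1} {w} (subst (w <_) (sym (*-identityʳ k)) (≰⇒> k≰w)) =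
      sym (sumTo-≡0 ℓ′ (λ β _ → cong (λ b → if b then H β (w ∸ (k + suc k * β)) else 0)
                                     (>⇒≤ᵇ≡false (<-≤-trans (≰⇒> k≰w) (m≤m+n k _)))))

  HP-odd : HP r k ℓ w ≡ sumTo (λ β → shift (suc k * β) (H β) w) ℓ + sumTo (λ β → shift (k + suc k * β) (H β) w) ℓ′
  HP-odd = begin
    HP r k ℓ w              ≡⟨ HP≡sum-rows ⟩
    sumTo row (suc w)       ≡⟨ sumTo-cutoff (suc w) 2 row-heavy row-≥2 ⟩
    (0 + row 0) + row 1     ≡⟨ cong₂ (λ x y → (0 + x) + y) row-0 row-1 ⟩
    _                       ∎

Ninit-expansion : ∀ r J ℓ′ w → suc ℓ′ ≤ r →
  ΣS (λ j → Ninit r J (suc ℓ′) j ⊛ HP r (2 * suc J + 1) (suc r ∸ j)) r w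
  ≡ sumTo (λ β → shift (2 * suc J * suc β ∸ 1) (HP r (2 * suc J + 1) (r ∸ β)) w) ℓ′
    + sumTo (λ β → shift (2 * suc J * β) (HP r (2 * suc J + 1) (r ∸ β)) w) (suc ℓ′)
Ninit-expansion r J ℓ′ w ℓ≤r = begin
  ΣS (λ j → Ninit r J ℓ j ⊛ H (suc r ∸ j)) r w
    ≡⟨ ΣS-sumTo _ r w ⟩
  sumTo (λ β → (Ninit r J ℓ (suc β) ⊛ H (r ∸ β)) w) r
    ≡⟨ sumTo-cong r (λ β _ → Ninit-⊛ r J ℓ (suc β) (H (r ∸ β)) w) ⟩
  sumTo (λ β → (if suc β ≤ᵇ ℓ′ then shift (B β) (H (r ∸ β)) w else 0)
             + (if suc β ≤ᵇ ℓ then shift (A β) (H (r ∸ β)) w else 0)) r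
    ≡⟨ sumTo-+ _ _ r ⟩
  sumTo (λ β → if suc β ≤ᵇ ℓ′ then shift (B β) (H (r ∸ β)) w else 0) r
    + sumTo (λ β → if suc β ≤ᵇ ℓ then shift (A β) (H (r ∸ β)) w else 0) r
    ≡⟨ cong₂ _+_ (sumTo-if< (λ β → shift (B β) (H (r ∸ β)) w) ℓ′ r (≤-trans (n≤1+n ℓ′) ℓ≤r))
                 (sumTo-if< (λ β → shift (A β) (H (r ∸ β)) w) ℓ r ℓ≤r) ⟩
  sumTo (λ β → shift (B β) (H (r ∸ β)) w) ℓ′ + sumTo (λ β → shift (A β) (H (r ∸ β)) w) ℓ ∎
  where
  ℓ = suc ℓ′
  H : ℕ → Series
  H = HP r (2 * suc J + 1)
  A B : ℕ → ℕ
  A β = 2 * suc J * β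
  B β = 2 * suc J * suc β ∸ 1

initialExpansion : ∀ r′ → InitialExpansion (suc (suc r′))
initialExpansion r′ J (suc ℓ′) _ ℓ≤r w = begin
  HP r k (suc ℓ′) w
    ≡⟨ OddExpansion.HP-odd r′ k ℓ′ w (isOdd-2*J+1 J) (m≤n+m 1 (2 * J)) ℓ≤r ⟩
  Σ₀ + Σ₁
    ≡⟨ +-comm Σ₀ Σ₁ ⟩
  Σ₁ + Σ₀
    ≡⟨ cong₂ _+_ (sumTo-cong ℓ′ (λ β _ → cong₂ (λ a K → shift a (HP r K (r ∸ β)) w) (k+[k+1]β≡ β) k+2≡))
                 (sumTo-cong (suc ℓ′) (λ β _ → cong₂ (λ a K → shift a (HP r K (r ∸ β)) w) (cong (_* β) k+1≡) k+2≡)) ⟩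
  sumTo (λ β → shift (2 * suc J * suc β ∸ 1) (HP r (2 * suc J + 1) (r ∸ β)) w) ℓ′
    + sumTo (λ β → shift (2 * suc J * β) (HP r (2 * suc J + 1) (r ∸ β)) w) (suc ℓ′)
    ≡⟨ sym (Ninit-expansion r J ℓ′ w ℓ≤r) ⟩
  ΣS (λ j → Ninit r J (suc ℓ′) j ⊛ HP r (2 * suc J + 1) (suc r ∸ j)) r w ∎
  where
  r = suc (suc r′)
  k = 2 * J + 1
  Σ₀ = sumTo (λ β → shift (suc k * β) (HP r (suc (suc k)) (r ∸ β)) w) (suc ℓ′)
  Σ₁ = sumTo (λ β → shift (k + suc k * β) (HP r (suc (suc k)) (r ∸ β)) w) ℓ′
  k+1≡ : suc k ≡ 2 * suc J
  k+1≡ = trans (cong suc (+-comm (2 * J) 1)) (sym (*-suc 2 J))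
  k+2≡ : suc (suc k) ≡ 2 * suc J + 1
  k+2≡ = cong (_+ 1) (sym (*-suc 2 J))
  k+[k+1]β≡ : ∀ β → k + suc k * β ≡ 2 * suc J * suc β ∸ 1
  k+[k+1]β≡ β = sym (cong (_∸ 1) (trans (cong (_* suc β) (sym k+1≡)) (*-suc (suc k) β)))

lemma2p2 : (r J i : ℕ) → 2 ≤ r → 1 ≤ i → i ≤ r →
    (d : ℕ) → suc J ≤ d →
    (w : ℕ) →
      HP r (2 * J + 1) i w
        ≡ ΣS (λ j → N r J i d j ⊛ HP r (2 * d + 1) (suc r ∸ j)) r w
lemma2p2 (suc (suc r′)) J i (s≤s (s≤s z≤n)) 1≤i i≤r d J<d w =
  subst (λ D → HP r (2 * J + 1) i w ≡ ΣS (λ j → N r J i d j ⊛ HP r (2 * D + 1) (suc r ∸ j)) r w)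
        (m+[n∸m]≡n J<d)
        (expansion r J i (initialExpansion r′) 1≤i i≤r (d ∸ suc J) w)
  where r = suc (suc r′)
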